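{- Let $p$ be a prime, let $q=p^h$ be a power of $p$ that is not prime, and let $k$ be a positive integer. Let $S$ be a set of vectors of ${\mathbb F}_q^k$ with the property that every subset of $S$ of size $k$ is a basis of ${\mathbb F}_q^k$. If $k \leq 2p-2$ then $|S| \leq q+1$.
   Context: ${\mathbb F}_q$ denotes the finite field with $q$ elements. -}

module Defs where

open import Algebra.Apartness.Bundles using (HeytingCommutativeRing; HeytingField)
open import Algebra.Bundles using (CommutativeRing)
open import Data.Fin using (Fin)
open import Data.List using (List; length; lookup)
open import Data.Nat using (ℕ)
open import Data.Product using (_×_; ∃-syntax)
open import Data.Vec.Functional using (Vector; replicate)
open import Function.Bundles using (Inverse)
open import Level using (_⊔_)
open import Relation.Binary.Bundles using (Setoid)
open import Relation.Binary.PropositionalEquality using (_≡_)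
import Algebra.Properties.Monoid.Sum as MonoidSum
import Data.List.Relation.Binary.Subset.Setoid as ListSubset
import Data.List.Relation.Unary.Unique.Setoid as UniqueSetoid
import Data.Vec.Functional.Relation.Binary.Equality.Setoid as VectorEquality
import Relation.Binary.PropositionalEquality as ≡

HasCardinality : ∀ {a ℓ} → Setoid a ℓ → ℕ → Set (a ⊔ ℓ)
HasCardinality A n = Inverse A (≡.setoid (Fin n))

-- A finite field is a `HeytingField F` with `HasCardinality (setoid F) q`.
-- For a finite carrier `_≈_` is decidable, and then the Heyting axioms are
-- the usual ones: `x # y` means `¬ (x ≈ y)`, every element apart from zero is
-- invertible, and `1# # 0#` (put `x = 1#`, `y = 0#` in `invertible⇒#`).
module VectorSpace {c ℓ₁ ℓ₂} (F : HeytingField c ℓ₁ ℓ₂) where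

  open HeytingField F
  open HeytingCommutativeRing heytingCommutativeRing using (commutativeRing)
  open CommutativeRing commutativeRing using (+-monoid)
  open MonoidSum +-monoid using (sum-syntax)
  open VectorEquality setoid using (_≋_; ≋-setoid)

  linearCombination : ∀ {k n} → Vector Carrier n → Vector (Vector Carrier k) n →
                      Vector Carrier k
  linearCombination {n = n} a v j = ∑[ i < n ] (a i * v i j)

  LinearlyIndependent : ∀ {k n} → Vector (Vector Carrier k) n → Set (c ⊔ ℓ₁)
  LinearlyIndependent {k} {n} v =
    (a : Vector Carrier n) →
    linearCombination a v ≋ replicate k 0# → a ≋ replicate n 0#

  Spanning : ∀ {k n} → Vector (Vector Carrier k) n → Set (c ⊔ ℓ₁)
  Spanning {k} {n} v =
    (w : Vector Carrier k) → ∃[ a ] linearCombination a v ≋ w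

  IsBasis : ∀ {k n} → Vector (Vector Carrier k) n → Set (c ⊔ ℓ₁)
  IsBasis v = LinearlyIndependent v × Spanning v

  -- A finite set of vectors is a list `S` with `Unique S`, and `length S` is
  -- then its cardinality. `_⊆_` is inclusion of the sets of members,
  -- irrespective of order.
  module _ {k : ℕ} where
    open UniqueSetoid (≋-setoid k) public using (Unique)
    open ListSubset (≋-setoid k) public using (_⊆_)

  EverySubsetOfSizeIsBasis : ∀ {k} → ℕ → List (Vector Carrier k) → Set (c ⊔ ℓ₁)
  EverySubsetOfSizeIsBasis {k} m S =
    (T : List (Vector Carrier k)) → Unique T → T ⊆ S → length T ≡ m →
    IsBasis (lookup T)

{-# OPTIONS --safe #-}
module Submission where

-- Suppose |S| = q + 2 and k ≥ 2, and write k = n + r + 1 with n = max(k - p, 0), so that r < p.  For a (k - 1)-set C of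
-- vectors and a (2k - 3)-set G ⊆ S containing C let
--     β(C) = ∏ det(s, C)⁻¹,   s ranging over S \ C and over G \ C.
-- There are q + 1 factors and σ^(q + 1) = 1 for σ = ±1, so β(C) does not depend on the order of C.  Projecting from a
-- (k - 2)-set Y ⊆ G to a plane, Lagrange interpolation gives ∑ β(Y ∪ {a}) = 0, the sum being over a ∈ G \ Y.  For
-- k ≤ p this system has the single solution β = 0, whereas β never vanishes.
--
-- In general, fix n disjoint pairs in G, adjoin one member of each to an r-set V, and sum β with alternating signs
-- over the 2ⁿ choices.  The alternating sums satisfy the same system with r in place of k - 1, so they vanish.  The
-- hyperplanes occurring are spanned by V and one member of each pair; the rest Z of G enters only through the factors
-- det(z, C)⁻¹.  As |Z| = r - 1 ≥ n, which is the condition k ≤ 2p - 2, Z can be varied to eliminate the pairs one by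
-- one, until a single nonzero term is left.  Since q ≥ p², there are enough vectors in S for this.

open import Defs
open import Algebra.Apartness.Bundles using (HeytingField)
open import Algebra.Bundles using (CommutativeRing; RawRing)
open import Algebra.Core using (Op₁; Op₂)
import Algebra.Morphism.RingMonomorphism as RingMonomorphism
open import Algebra.Morphism.Structures using (IsRingMonomorphism)
import Algebra.Properties.Semiring.Mult as SemiringMult
open import Algebra.Structures using (IsCommutativeMonoid; IsCommutativeRing)
open import Data.Empty using (⊥; ⊥-elim)
open import Data.Fin using (Fin; zero; suc; inject≤)
open import Data.Fin.Properties using (_≟_; any?; pigeonhole; inject≤-injective; <⇒≢)
open import Data.List using (List; []; _∷_; [_]; _++_; map; length; allFin; drop; lookup; tabulate)
open import Data.List.Membership.DecPropositional using (_∈?_)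
open import Data.List.Membership.Propositional using (_∈_; _∉_)
open import Data.List.Membership.Propositional.Properties
  using (∈-∃++; ∈-++⁺ˡ; ∈-++⁺ʳ; ∈-++⁻; ∈-allFin; ∈-map⁻; ∈-map⁺)
import Data.List.Membership.Setoid.Properties as SetoidMembershipₚ
open import Data.List.Properties
  using (++-assoc; ++-identityʳ; length-map; length-++; map-++; length-tabulate)
open import Data.List.Relation.Binary.Permutation.Propositional
  using (_↭_; refl; prep; swap; trans; ↭-sym; ↭-trans)
open import Data.List.Relation.Binary.Permutation.Propositional.Properties
  using (shift; shifts; ++-comm; ++⁺ˡ; ++⁺ʳ; ++⁺; map⁺; ↭-length; ∈-resp-↭; All-resp-↭)
open import Data.List.Relation.Binary.Subset.Propositional using (_⊆_)
open import Data.List.Relation.Unary.All as All using ([]; _∷_)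
open import Data.List.Relation.Unary.AllPairs using ([]; _∷_)
open import Data.List.Relation.Unary.Any using (here; there)
open import Data.List.Relation.Unary.Unique.DecPropositional using (unique?)
open import Data.List.Relation.Unary.Unique.Propositional using () renaming (Unique to Distinct)
open import Data.List.Relation.Unary.Unique.Propositional.Properties
  using (Unique[x∷xs]⇒x∉xs; allFin⁺)
import Data.List.Relation.Unary.Unique.Setoid as UniqueSetoid
import Data.List.Relation.Unary.Unique.Setoid.Properties as UniqueSetoidₚ
open import Data.Nat as ℕ using (ℕ; zero; suc)
open import Data.Nat.Coprimality using (prime⇒coprime; coprime-Bézout)
open import Data.Nat.GCD using (module Bézout)
open import Data.Nat.Primality using (Prime; prime⇒nonTrivial)
import Data.Nat.Properties as ℕₚ
open import Data.Nat.Tactic.RingSolver using (solve-∀)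
open import Data.Product using (_×_; _,_; ∃-syntax; ∃₂; proj₁; proj₂)
open import Data.Sum using (inj₁; inj₂)
open import Data.Vec as Vec using (Vec; []; _∷_; tail)
import Data.Vec.Properties as Vecₚ
open import Data.Vec.Functional using (Vector)
import Data.Vec.Functional.Relation.Binary.Equality.Setoid as VectorEquality
open import Function using (_∘_)
open import Function.Bundles using (Inverse)
open import Relation.Binary.Bundles using (Setoid)
open import Relation.Binary.PropositionalEquality
  using (_≡_; _≢_; refl; sym; cong; cong₂; subst; subst₂; module ≡-Reasoning)
  renaming (trans to ≡-trans)
import Relation.Binary.PropositionalEquality as ≡
open import Relation.Nullary using (¬_; Dec; yes; no; contradiction; _×-dec_)
open import Relation.Nullary.Decidable using (map′)

-- The size 2k - 3 of G answers two demands at once. Seen from the k - 2 vectors of Y, the other q +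
-- 4 - k vectors of S take distinct directions in a plane, which leaves k - 3 of the q + 1
-- directions free. The tangent function therefore has degree k - 3, and its interpolation sum
-- vanishes on k - 1 nodes; with Y these make 2k - 3. The same size leaves q + 1 factors in β, and
-- σ^(q + 1) = σ² because σ^q = σ in the field, whatever the parity of q. The system concerns the
-- m-subsets of a set of size 2m - 1, with m = k - 1. Solving it divides by integers up to m, so in
-- characteristic p it stops at m = p - 1: this is the obstacle for k > p. A pair {x, y} repairs it.
-- The difference of the values at V ∪ {x} and V ∪ {y} is subject to the relations on (m -
-- 1)-subsets of the ground set without x and y, of size 2(m - 1) - 1. The shape is kept, and n
-- pairs bring m down to r < p.

-- Duplicate-free lists up to permutation.

module _ {A : Set} where

  unique-↭ : {xs ys : List A} → xs ↭ ys → Distinct xs → Distinct ys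
  unique-↭ refl u = u
  unique-↭ (prep x p) (x∉ ∷ u) = All-resp-↭ p x∉ ∷ unique-↭ p u
  unique-↭ (swap x y p) ((x≢y ∷ x∉) ∷ y∉ ∷ u) =
    ((x≢y ∘ sym) ∷ All-resp-↭ p y∉) ∷ All-resp-↭ p x∉ ∷ unique-↭ p u
  unique-↭ (trans p p′) u = unique-↭ p′ (unique-↭ p u)

  unique-∷ : {x : A} {xs : List A} → x ∉ xs → Distinct xs → Distinct (x ∷ xs)
  unique-∷ x∉ u = All.tabulate (λ {y} y∈ x≡y → x∉ (subst (_∈ _) (sym x≡y) y∈)) ∷ u

  unique-tail : {x : A} {xs : List A} → Distinct (x ∷ xs) → Distinct xs
  unique-tail (_ ∷ u) = u

  unique-++ʳ : (xs : List A) {ys : List A} → Distinct (xs ++ ys) → Distinct ys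
  unique-++ʳ [] u = u
  unique-++ʳ (x ∷ xs) (_ ∷ u) = unique-++ʳ xs u

  unique-++ˡ : (xs : List A) {ys : List A} → Distinct (xs ++ ys) → Distinct xs
  unique-++ˡ xs {ys} u = unique-++ʳ ys (unique-↭ (++-comm xs ys) u)

  disjoint : (xs : List A) {ys : List A} {x : A} → Distinct (xs ++ ys) → x ∈ xs → x ∉ ys
  disjoint (x ∷ xs) (x∉ ∷ _) (here refl) x∈ys = All.lookup x∉ (∈-++⁺ʳ xs x∈ys) refl
  disjoint (x ∷ xs) (_ ∷ u) (there x∈xs) x∈ys = disjoint xs u x∈xs x∈ys

  ∈-split : {x : A} {xs : List A} → x ∈ xs → ∃[ ys ] xs ↭ x ∷ ys
  ∈-split x∈xs with ys , zs , refl ← ∈-∃++ x∈xs = ys ++ zs , shift _ ys zs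

  complement : {xs ys : List A} → Distinct xs → xs ⊆ ys → ∃[ zs ] ys ↭ xs ++ zs
  complement {[]} {ys} _ _ = ys , refl
  complement {x ∷ xs} (x∉xs ∷ u) sub with ys′ , p ← ∈-split (sub (here refl)) =
    let zs , p′ = complement u sub′ in zs , ↭-trans p (prep x p′)
    where
    sub′ : xs ⊆ ys′
    sub′ z∈xs with ∈-resp-↭ p (sub (there z∈xs))
    ... | here refl = ⊥-elim (All.lookup x∉xs z∈xs refl)
    ... | there z∈ys′ = z∈ys′

  ⊆∧length⇒↭ : {xs ys : List A} → Distinct xs → xs ⊆ ys → length xs ≡ length ys → ys ↭ xs
  ⊆∧length⇒↭ {xs} {ys} u sub eq with complement u sub
  ... | [] , p = subst (ys ↭_) (++-identityʳ xs) p
  ... | z ∷ zs , p = contradiction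
    (ℕₚ.+-cancelˡ-≡ (length xs) _ _
      (≡-trans (ℕₚ.+-identityʳ _) (≡-trans eq (≡-trans (↭-length p) (length-++ xs)))))
    λ ()

unique-map : {A B : Set} {h : A → B} {xs : List A} →
  (∀ {x y} → x ∈ xs → y ∈ xs → h x ≡ h y → x ≡ y) → Distinct xs → Distinct (map h xs)
unique-map {xs = []} inj [] = []
unique-map {h = h} {xs = x ∷ xs} inj (x∉ ∷ u) =
    unique-∷ hx∉ (unique-map (λ y∈ z∈ → inj (there y∈) (there z∈)) u)
  where
  hx∉ : h x ∉ map h xs
  hx∉ hx∈ with y , y∈ , eq ← ∈-map⁻ h hx∈ = All.lookup x∉ y∈ (inj (here refl) (there y∈) eq)

-- Sums and products over lists.

module BigOperator {A : Set} {_∙_ : Op₂ A} {ε : A}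
                   (isCM : IsCommutativeMonoid _≡_ _∙_ ε) where
  open IsCommutativeMonoid isCM using (assoc; comm; identityˡ)

  big : {B : Set} → (B → A) → List B → A
  big f [] = ε
  big f (x ∷ xs) = f x ∙ big f xs

  interchange : ∀ a b c d → (a ∙ b) ∙ (c ∙ d) ≡ (a ∙ c) ∙ (b ∙ d)
  interchange a b c d = begin
    (a ∙ b) ∙ (c ∙ d)  ≡⟨ assoc a b _ ⟩
    a ∙ (b ∙ (c ∙ d))  ≡⟨ cong (a ∙_) (sym (assoc b c d)) ⟩
    a ∙ ((b ∙ c) ∙ d)  ≡⟨ cong (λ e → a ∙ (e ∙ d)) (comm b c) ⟩
    a ∙ ((c ∙ b) ∙ d)  ≡⟨ cong (a ∙_) (assoc c b d) ⟩
    a ∙ (c ∙ (b ∙ d))  ≡⟨ sym (assoc a c _) ⟩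
    (a ∙ c) ∙ (b ∙ d)  ∎
    where open ≡-Reasoning

  leftComm : ∀ a b c → a ∙ (b ∙ c) ≡ b ∙ (a ∙ c)
  leftComm a b c = ≡-trans (sym (assoc a b c)) (≡-trans (cong (_∙ c) (comm a b)) (assoc b a c))

  module _ {B : Set} where

    big-cong : {f g : B → A} (xs : List B) → (∀ {x} → x ∈ xs → f x ≡ g x) → big f xs ≡ big g xs
    big-cong [] eq = refl
    big-cong (x ∷ xs) eq = cong₂ _∙_ (eq (here refl)) (big-cong xs (eq ∘ there))

    big-ε : {f : B → A} (xs : List B) → (∀ {x} → x ∈ xs → f x ≡ ε) → big f xs ≡ ε
    big-ε [] eq = refl
    big-ε (x ∷ xs) eq = ≡-trans (cong₂ _∙_ (eq (here refl)) (big-ε xs (eq ∘ there))) (identityˡ ε)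

    big-++ : (f : B → A) (xs ys : List B) → big f (xs ++ ys) ≡ big f xs ∙ big f ys
    big-++ f [] ys = sym (identityˡ _)
    big-++ f (x ∷ xs) ys = ≡-trans (cong (f x ∙_) (big-++ f xs ys)) (sym (assoc _ _ _))

    big-↭ : (f : B → A) {xs ys : List B} → xs ↭ ys → big f xs ≡ big f ys
    big-↭ f refl = refl
    big-↭ f (prep x p) = cong (f x ∙_) (big-↭ f p)
    big-↭ f (swap x y p) = ≡-trans (leftComm _ _ _) (cong (λ e → f y ∙ (f x ∙ e)) (big-↭ f p))
    big-↭ f (trans p p′) = ≡-trans (big-↭ f p) (big-↭ f p′)

    big-∙ : (f g : B → A) (xs : List B) → big (λ x → f x ∙ g x) xs ≡ big f xs ∙ big g xs
    big-∙ f g [] = sym (identityˡ ε)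
    big-∙ f g (x ∷ xs) = ≡-trans (cong (_ ∙_) (big-∙ f g xs)) (interchange _ _ _ _)

    big-map : {C : Set} (f : B → A) (h : C → B) (xs : List C) → big f (map h xs) ≡ big (f ∘ h) xs
    big-map f h [] = refl
    big-map f h (x ∷ xs) = cong (_ ∙_) (big-map f h xs)

-- The field is transported to Fin q so that its equality is propositional.
record FiniteField (q : ℕ) : Set where
  infixl 7 _*_
  infixl 6 _+_
  infix 8 -_
  field
    _+_ _*_ : Op₂ (Fin q)
    -_ : Op₁ (Fin q)
    0# 1# : Fin q
    isCommutativeRing : IsCommutativeRing _≡_ _+_ _*_ -_ 0# 1#
    1≢0 : 1# ≢ 0#
    inverse : ∀ {x} → x ≢ 0# → ∃[ y ] x * y ≡ 1#

-- Arithmetic of a finite field, up to Fermat's little theorem.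

module FieldProperties {q : ℕ} (𝔽 : FiniteField q) where

  F : Set
  F = Fin q

  open FiniteField 𝔽 public

  commutativeRing : CommutativeRing _ _
  commutativeRing = record { isCommutativeRing = isCommutativeRing }

  open CommutativeRing commutativeRing public
    using ( commutativeSemiring; ring; semiring; _-_; +-isCommutativeMonoid; *-isCommutativeMonoid
          ; +-assoc; +-comm; +-identityˡ
          ; +-identityʳ; -‿inverseˡ; -‿inverseʳ; *-assoc; *-comm; *-identityˡ; *-identityʳ
          ; zeroˡ; zeroʳ; distribˡ; distribʳ)
  open import Algebra.Properties.Ring ring public
    using (-‿distribˡ-*; -‿distribʳ-*; -‿involutive; -0#≈0#; +-cancelˡ; +-cancelʳ; -‿+-comm; -1*x≈-x)

  open import Algebra.Solver.Ring.NaturalCoefficients.Default commutativeSemiring public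
    using (solve; _:=_; _:+_; _:*_; con)

  module Σ = BigOperator +-isCommutativeMonoid
  module Π = BigOperator *-isCommutativeMonoid

  ∑ ∏ : {B : Set} → (B → F) → List B → F
  ∑ = Σ.big
  ∏ = Π.big

  open ≡-Reasoning

  ∑-*ˡ : {B : Set} (a : F) (f : B → F) (xs : List B) → ∑ (λ x → a * f x) xs ≡ a * ∑ f xs
  ∑-*ˡ a f [] = sym (zeroʳ a)
  ∑-*ˡ a f (x ∷ xs) = ≡-trans (cong (_ +_) (∑-*ˡ a f xs)) (sym (distribˡ a _ _))

  infixr 9 _^_
  _^_ : F → ℕ → F
  x ^ zero = 1#
  x ^ suc n = x * x ^ n

  ∏-const : {B : Set} (a : F) (xs : List B) → ∏ (λ _ → a) xs ≡ a ^ length xs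
  ∏-const a [] = refl
  ∏-const a (x ∷ xs) = cong (a *_) (∏-const a xs)

  *-cancelˡ-nonZero : ∀ {a b c} → a ≢ 0# → a * b ≡ a * c → b ≡ c
  *-cancelˡ-nonZero {a} {b} {c} a≢0 eq = begin
    b              ≡⟨ lemma b ⟩
    a⁻¹ * (a * b)  ≡⟨ cong (a⁻¹ *_) eq ⟩
    a⁻¹ * (a * c)  ≡⟨ sym (lemma c) ⟩
    c              ∎
    where
    a⁻¹ = proj₁ (inverse a≢0)
    lemma : ∀ d → d ≡ a⁻¹ * (a * d)
    lemma d = sym (begin
      a⁻¹ * (a * d)  ≡⟨ sym (*-assoc a⁻¹ a d) ⟩
      a⁻¹ * a * d    ≡⟨ cong (_* d) (≡-trans (*-comm a⁻¹ a) (proj₂ (inverse a≢0))) ⟩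
      1# * d         ≡⟨ *-identityˡ d ⟩
      d              ∎)

  a*b≡0⇒b≡0 : ∀ {a b} → a ≢ 0# → a * b ≡ 0# → b ≡ 0#
  a*b≡0⇒b≡0 a≢0 eq = *-cancelˡ-nonZero a≢0 (≡-trans eq (sym (zeroʳ _)))

  *-nonZero : ∀ {a b} → a ≢ 0# → b ≢ 0# → a * b ≢ 0#
  *-nonZero a≢0 b≢0 eq = b≢0 (a*b≡0⇒b≡0 a≢0 eq)

  -- The inverse, with the convention θ 0# ≡ 1#: a vanishing factor drops out of a product.
  θ : F → F
  θ x with x ≟ 0#
  ... | yes _ = 1#
  ... | no x≢0 = proj₁ (inverse x≢0)

  θ-0 : θ 0# ≡ 1#
  θ-0 with 0# ≟ 0#
  ... | yes _ = refl
  ... | no 0≢0 = contradiction refl 0≢0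

  θ-inverseʳ : ∀ {x} → x ≢ 0# → x * θ x ≡ 1#
  θ-inverseʳ {x} x≢0 with x ≟ 0#
  ... | yes x≡0 = contradiction x≡0 x≢0
  ... | no x≢0′ = proj₂ (inverse x≢0′)

  θ-inverseˡ : ∀ {x} → x ≢ 0# → θ x * x ≡ 1#
  θ-inverseˡ x≢0 = ≡-trans (*-comm _ _) (θ-inverseʳ x≢0)

  θ≢0 : ∀ x → θ x ≢ 0#
  θ≢0 x with x ≟ 0#
  ... | yes _ = 1≢0
  ... | no x≢0 = λ eq → 1≢0 (≡-trans (sym (proj₂ (inverse x≢0))) (≡-trans (cong (x *_) eq) (zeroʳ x)))

  θ-unique : ∀ {x y} → x * y ≡ 1# → θ x ≡ y
  θ-unique {x} {y} eq = *-cancelˡ-nonZero x≢0 (≡-trans (θ-inverseʳ x≢0) (sym eq))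
    where
    x≢0 : x ≢ 0#
    x≢0 refl = 1≢0 (≡-trans (sym eq) (zeroˡ y))

  θ-* : ∀ {x y} → x ≢ 0# → y ≢ 0# → θ (x * y) ≡ θ x * θ y
  θ-* {x} {y} x≢0 y≢0 = θ-unique (begin
    x * y * (θ x * θ y)    ≡⟨ Π.interchange x y (θ x) (θ y) ⟩
    x * θ x * (y * θ y)    ≡⟨ cong₂ _*_ (θ-inverseʳ x≢0) (θ-inverseʳ y≢0) ⟩
    1# * 1#                ≡⟨ *-identityˡ 1# ⟩
    1#                     ∎)

  θθ : ∀ {x} → x ≢ 0# → θ (θ x) ≡ x
  θθ x≢0 = θ-unique (θ-inverseˡ x≢0)

  ∏≢0 : {B : Set} (f : B → F) (xs : List B) → (∀ {x} → x ∈ xs → f x ≢ 0#) → ∏ f xs ≢ 0#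
  ∏≢0 f [] ne = 1≢0
  ∏≢0 f (x ∷ xs) ne = *-nonZero (ne (here refl)) (∏≢0 f xs (ne ∘ there))

  elements : List F
  elements = allFin q

  map-elements : (h : F → F) → (∀ {x y} → h x ≡ h y → x ≡ y) → elements ↭ map h elements
  map-elements h inj = ⊆∧length⇒↭ (unique-map (λ _ _ → inj) (allFin⁺ q)) (λ {x} _ → ∈-allFin x)
      (length-map h elements)

  -- The product of the nonzero elements is unchanged when all of them are multiplied by x.
  fermat : ∀ {x} → x ≢ 0# → ∃[ m ] suc m ≡ q × x ^ m ≡ 1#
  fermat {x} x≢0 with ys , p ← ∈-split (∈-allFin 0#) =
    length ys , ≡-trans (sym (↭-length p)) (length-tabulate (λ i → i)) , xᵐ≡1
    where
    ys≢0 : ∀ {y} → y ∈ ys → y ≢ 0#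
    ys≢0 y∈ys refl = Unique[x∷xs]⇒x∉xs (unique-↭ p (allFin⁺ q)) y∈ys
    -- `θ ∘ θ` fixes the nonzero elements and sends zero to one, so this product may be taken over
    -- the whole field, which multiplication by `x` permutes.
    P : F
    P = ∏ (θ ∘ θ) ys
    xᵐP≡P : x ^ length ys * P ≡ P
    xᵐP≡P = begin
      x ^ length ys * P
        ≡⟨ cong (_* P) (sym (∏-const x ys)) ⟩
      ∏ (λ _ → x) ys * P
        ≡⟨ sym (Π.big-∙ _ _ ys) ⟩
      ∏ (λ y → x * θ (θ y)) ys
        ≡⟨ Π.big-cong ys (λ {y} y∈ →
            ≡-trans (cong (x *_) (θθ (ys≢0 y∈))) (sym (θθ (*-nonZero x≢0 (ys≢0 y∈))))) ⟩
      ∏ (λ y → θ (θ (x * y))) ys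
        ≡⟨ sym (*-identityˡ _) ⟩
      1# * ∏ (λ y → θ (θ (x * y))) ys
        ≡⟨ cong (_* ∏ (λ y → θ (θ (x * y))) ys) (sym (≡-trans (cong (θ ∘ θ) (zeroʳ x)) θθ0)) ⟩
      ∏ (λ y → θ (θ (x * y))) (0# ∷ ys)
        ≡⟨ sym (Π.big-↭ _ p) ⟩
      ∏ (λ y → θ (θ (x * y))) elements
        ≡⟨ sym (Π.big-map (θ ∘ θ) (x *_) elements) ⟩
      ∏ (θ ∘ θ) (map (x *_) elements)
        ≡⟨ sym (Π.big-↭ _ (map-elements (x *_) (*-cancelˡ-nonZero x≢0))) ⟩
      ∏ (θ ∘ θ) elements
        ≡⟨ Π.big-↭ _ p ⟩
      θ (θ 0#) * P
        ≡⟨ cong (_* P) θθ0 ⟩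
      1# * P
        ≡⟨ *-identityˡ P ⟩
      P ∎
      where
      θθ0 : θ (θ 0#) ≡ 1#
      θθ0 = ≡-trans (cong θ θ-0) (θ-unique (*-identityˡ 1#))
    xᵐ≡1 : x ^ length ys ≡ 1#
    xᵐ≡1 = *-cancelˡ-nonZero (∏≢0 (θ ∘ θ) ys (λ {y} _ → θ≢0 (θ y)))
      (≡-trans (*-comm P _) (≡-trans xᵐP≡P (sym (*-identityʳ P))))

  x^q≡x : ∀ {x} → x ≢ 0# → x ^ q ≡ x
  x^q≡x {x} x≢0 with m , refl , eq ← fermat x≢0 = ≡-trans (cong (x *_) eq) (*-identityʳ x)

  ∑-translate : ∀ (f : F → F) c → ∑ (λ x → f (x + c)) elements ≡ ∑ f elements
  ∑-translate f c = ≡-trans (sym (Σ.big-map f (_+ c) elements))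
      (sym (Σ.big-↭ f (map-elements (_+ c) (+-cancelʳ c _ _))))

  ∏-translate : ∀ (f : F → F) c → ∏ (λ x → f (x + c)) elements ≡ ∏ f elements
  ∏-translate f c = ≡-trans (sym (Π.big-map f (_+ c) elements))
      (sym (Π.big-↭ f (map-elements (_+ c) (+-cancelʳ c _ _))))

-- Integers that are invertible in the field.

module Characteristic {q : ℕ} (𝔽 : FiniteField q) where

  open FieldProperties 𝔽
  open SemiringMult semiring using (×1-homo-*) renaming (_×_ to _·_)
  open ≡-Reasoning

  ∑-1 : {B : Set} (xs : List B) → ∑ (λ _ → 1#) xs ≡ length xs · 1#
  ∑-1 [] = refl
  ∑-1 (x ∷ xs) = cong (1# +_) (∑-1 xs)

  -- Translation by `1#` permutes the elements, so adding one to each of them leaves their sum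
  -- unchanged.
  q·1≡0 : q · 1# ≡ 0#
  q·1≡0 = +-cancelˡ (∑ (λ x → x) elements) _ _ (begin
    ∑ (λ x → x) elements + q · 1#
      ≡⟨ cong (λ n → ∑ (λ x → x) elements + n · 1#) (sym (length-tabulate {n = q} (λ i → i))) ⟩
    ∑ (λ x → x) elements + length elements · 1#
      ≡⟨ cong (∑ (λ x → x) elements +_) (sym (∑-1 elements)) ⟩
    ∑ (λ x → x) elements + ∑ (λ _ → 1#) elements
      ≡⟨ sym (Σ.big-∙ (λ x → x) (λ _ → 1#) elements) ⟩
    ∑ (λ x → x + 1#) elements
      ≡⟨ ∑-translate (λ x → x) 1# ⟩
    ∑ (λ x → x) elements
      ≡⟨ sym (+-identityʳ _) ⟩
    ∑ (λ x → x) elements + 0# ∎)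

  -- The image of p^h is the h-th power of the image of p, and a field has no zero divisors.
  p·1≡0 : ∀ p h → (p ℕ.^ h) · 1# ≡ 0# → p · 1# ≡ 0#
  p·1≡0 p zero eq = contradiction (≡-trans (sym (+-identityʳ 1#)) eq) 1≢0
  p·1≡0 p (suc h) eq with p · 1# ≟ 0#
  ... | yes p≡0 = p≡0
  ... | no p≢0 = p·1≡0 p h (a*b≡0⇒b≡0 p≢0 (≡-trans (sym (×1-homo-* p (p ℕ.^ h))) eq))

  bézout⇒⊥ : ∀ {m n} → m · 1# ≡ 0# → n · 1# ≡ 0# → ∀ x y → 1 ℕ.+ y ℕ.* n ≡ x ℕ.* m → ⊥
  bézout⇒⊥ m≡0 n≡0 x y eq = 1≢0 (begin
    1#                     ≡⟨ sym (+-identityʳ 1#) ⟩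
    1# + 0#                ≡⟨ cong (1# +_) (sym (multiple y n≡0)) ⟩
    (1 ℕ.+ y ℕ.* _) · 1#   ≡⟨ cong (_· 1#) eq ⟩
    (x ℕ.* _) · 1#         ≡⟨ multiple x m≡0 ⟩
    0#                     ∎)
    where
    multiple : ∀ {n} x → n · 1# ≡ 0# → (x ℕ.* n) · 1# ≡ 0#
    multiple {n} x n≡0 = ≡-trans (×1-homo-* x n) (≡-trans (cong (_ *_) n≡0) (zeroʳ _))

  -- Otherwise a Bézout identity for the coprime numbers `j` and `p` would give `1# ≡ 0#`.
  j·1≢0 : ∀ {p h j} → Prime p → q ≡ p ℕ.^ h → 0 ℕ.< j → j ℕ.< p → j · 1# ≢ 0#
  j·1≢0 {p} {h} {suc j} p-prime q≡pʰ _ j<p j≡0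
    with p≡0 ← p·1≡0 p h (subst (λ n → n · 1# ≡ 0#) q≡pʰ q·1≡0) | coprime-Bézout (prime⇒coprime p-prime j<p)
  ... | Bézout.+- x y eq = bézout⇒⊥ p≡0 j≡0 x y eq
  ... | Bézout.-+ x y eq = bézout⇒⊥ j≡0 p≡0 y x eq

-- Determinants of lists of vectors.

module Multilinear {q : ℕ} (𝔽 : FiniteField q) where

  open FieldProperties 𝔽
  open ≡-Reasoning

  -- Surplus entries of the longer list are ignored, so coefficient lists carry no length condition.
  dot : {B : Set} → List F → List B → (B → F) → F
  dot (c ∷ cs) (b ∷ bs) f = c * f b + dot cs bs f
  dot _ _ f = 0#

  dot-map : {B C : Set} (f : B → F) (h : C → B) (cs : List F) (bs : List C) → dot cs (map h bs) f
      ≡ dot cs bs (f ∘ h)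
  dot-map f h [] bs = refl
  dot-map f h (c ∷ cs) [] = refl
  dot-map f h (c ∷ cs) (b ∷ bs) = cong (_ +_) (dot-map f h cs bs)

  dot-zero : {B : Set} {f : B → F} (cs : List F) (bs : List B) → (∀ {b} → b ∈ bs → f b ≡ 0#) → dot cs bs f ≡ 0#
  dot-zero [] bs eq = refl
  dot-zero (c ∷ cs) [] eq = refl
  dot-zero (c ∷ cs) (b ∷ bs) eq = ≡-trans
    (cong₂ _+_ (≡-trans (cong (c *_) (eq (here refl))) (zeroʳ c)) (dot-zero cs bs (eq ∘ there)))
    (+-identityˡ 0#)

  infixl 6 _⊕_
  infixl 7 _⊙_

  _⊕_ : ∀ {k} → Vec F k → Vec F k → Vec F k
  [] ⊕ [] = []
  (a ∷ u) ⊕ (b ∷ v) = (a + b) ∷ (u ⊕ v)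

  _⊙_ : ∀ {k} → F → Vec F k → Vec F k
  c ⊙ [] = []
  c ⊙ (a ∷ u) = (c * a) ∷ (c ⊙ u)

  zeros : ∀ k → Vec F k
  zeros zero = []
  zeros (suc k) = 0# ∷ zeros k

  linearCombination : ∀ {k} → List F → List (Vec F k) → Vec F k
  linearCombination (c ∷ cs) (v ∷ vs) = c ⊙ v ⊕ linearCombination cs vs
  linearCombination _ _ = zeros _

  Form : ℕ → Set
  Form k = List (Vec F k) → F

  -- Antisymmetry does not imply alternation in characteristic 2, so both are carried along.
  -- Linearity and alternation concern only the head of the list; antisymmetry, with its prefix `L`,
  -- moves any vector there.
  Linear Alternating Antisymmetric : ∀ {k} → Form k → Set
  Linear D = ∀ c u v R → D (c ⊙ u ⊕ v ∷ R) ≡ c * D (u ∷ R) + D (v ∷ R)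
  Alternating D = ∀ u R → D (u ∷ u ∷ R) ≡ 0#
  Antisymmetric D = ∀ L u v R → D (L ++ u ∷ v ∷ R) ≡ - D (L ++ v ∷ u ∷ R)

  -- Laplace expansion along the first coordinate.
  expand : ∀ {k} → Form k → Form (suc k)
  expand D [] = 0#
  expand D ((a ∷ u) ∷ L) = a * D (map tail L) + - expand (λ M → D (u ∷ M)) L

  -- Lists whose length is not `k` get the value zero, so the laws below hold for lists of every
  -- length.
  det : ∀ k → Form k
  det zero [] = 1#
  det zero (_ ∷ _) = 0#
  det (suc k) = expand (det k)

  module _ {k : ℕ} where

    expand-cong : {D D′ : Form k} → (∀ M → D M ≡ D′ M) → ∀ L → expand D L ≡ expand D′ L
    expand-cong eq [] = refl
    expand-cong eq ((a ∷ u) ∷ L) =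
      cong₂ (λ e e′ → a * e + - e′) (eq _) (expand-cong (λ M → eq (u ∷ M)) L)

    expand-zero : {D : Form k} → (∀ M → D M ≡ 0#) → ∀ L → expand D L ≡ 0#
    expand-zero eq [] = refl
    expand-zero {D} eq ((a ∷ u) ∷ L) = begin
      a * D (map tail L) + - expand (λ M → D (u ∷ M)) L
        ≡⟨ cong₂ (λ e e′ → a * e + - e′) (eq _) (expand-zero (λ M → eq (u ∷ M)) L) ⟩
      a * 0# + - 0#   ≡⟨ cong₂ _+_ (zeroʳ a) -0#≈0# ⟩
      0# + 0#         ≡⟨ +-identityˡ 0# ⟩
      0#              ∎

    -- Linearity in the form, not in a vector: the first vector enters the recursive call of
    -- `expand` only through the form `λ M → D (u ∷ M)`.
    expand-linear : (c : F) (D D′ : Form k) → ∀ L →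
      expand (λ M → c * D M + D′ M) L ≡ c * expand D L + expand D′ L
    expand-linear c D D′ [] = sym (≡-trans (+-identityʳ _) (zeroʳ c))
    expand-linear c D D′ ((a ∷ u) ∷ L) = begin
      a * (c * d + d′) + - expand (λ M → c * D (u ∷ M) + D′ (u ∷ M)) L
        ≡⟨ cong₂ (λ x y → x + - y) (distribˡ a _ _) (expand-linear c (λ M → D (u ∷ M)) (λ M → D′ (u ∷ M)) L) ⟩
      (a * (c * d) + a * d′) + - (c * e + e′)
        ≡⟨ cong₂ (λ x y → (x + a * d′) + y)
             (≡-trans (sym (*-assoc a c d)) (≡-trans (cong (_* d) (*-comm a c)) (*-assoc c a d)))
             (≡-trans (sym (-‿+-comm (c * e) e′)) (cong (_+ - e′) (-‿distribʳ-* c e))) ⟩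
      (c * (a * d) + a * d′) + (c * - e + - e′)
        ≡⟨ Σ.interchange _ _ _ _ ⟩
      (c * (a * d) + c * - e) + (a * d′ + - e′)
        ≡⟨ cong (_+ (a * d′ + - e′)) (sym (distribˡ c _ _)) ⟩
      c * (a * d + - e) + (a * d′ + - e′) ∎
      where
      d d′ e e′ : F
      d = D (map tail L)
      d′ = D′ (map tail L)
      e = expand (λ M → D (u ∷ M)) L
      e′ = expand (λ M → D′ (u ∷ M)) L

    expand-neg : (D : Form k) → ∀ L → expand (λ M → - D M) L ≡ - expand D L
    expand-neg D L = begin
      expand (λ M → - D M) L
          ≡⟨ expand-cong (λ M → sym (≡-trans (+-identityʳ _) (-1*x≈-x (D M)))) L ⟩
      expand (λ M → - 1# * D M + 0#) L        ≡⟨ expand-linear (- 1#) D (λ _ → 0#) L ⟩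
      - 1# * expand D L + expand (λ _ → 0#) L ≡⟨ cong₂ _+_ (-1*x≈-x _) (expand-zero (λ _ → refl) L) ⟩
      - expand D L + 0#                       ≡⟨ +-identityʳ _ ⟩
      - expand D L                            ∎

    expand-isLinear : {D : Form k} → Linear D → Linear (expand D)
    expand-isLinear {D} lin c (a ∷ u) (b ∷ v) R = begin
      (c * a + b) * d + - expand (λ M → D (c ⊙ u ⊕ v ∷ M)) R
        ≡⟨ cong₂ (λ x y → x + - y) (distribʳ d (c * a) b)
             (≡-trans (expand-cong (lin c u v) R) (expand-linear c (λ M → D (u ∷ M)) (λ M → D (v ∷ M)) R)) ⟩
      (c * a * d + b * d) + - (c * e + e′)
        ≡⟨ cong₂ (λ x y → (x + b * d) + y) (*-assoc c a d)
             (≡-trans (sym (-‿+-comm (c * e) e′)) (cong (_+ - e′) (-‿distribʳ-* c e))) ⟩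
      (c * (a * d) + b * d) + (c * - e + - e′)
        ≡⟨ Σ.interchange _ _ _ _ ⟩
      (c * (a * d) + c * - e) + (b * d + - e′)
        ≡⟨ cong (_+ (b * d + - e′)) (sym (distribˡ c _ _)) ⟩
      c * (a * d + - e) + (b * d + - e′) ∎
      where
      d e e′ : F
      d = D (map tail R)
      e = expand (λ M → D (u ∷ M)) R
      e′ = expand (λ M → D (v ∷ M)) R

    neg-sub : ∀ a b → - (a + - b) ≡ b + - a
    neg-sub a b = ≡-trans (sym (-‿+-comm a (- b))) (≡-trans (+-comm _ _) (cong (_+ - a) (-‿involutive b)))

    expand-isAlternating : {D : Form k} → Alternating D → Alternating (expand D)
    expand-isAlternating {D} alt (a ∷ u) R = begin
      r + - (r + - expand (λ M → D (u ∷ u ∷ M)) R)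
        ≡⟨ cong (r +_) (neg-sub r _) ⟩
      r + (expand (λ M → D (u ∷ u ∷ M)) R + - r)
        ≡⟨ cong (λ e → r + (e + - r)) (expand-zero (alt u) R) ⟩
      r + (0# + - r)
        ≡⟨ cong (r +_) (+-identityˡ _) ⟩
      r + - r
        ≡⟨ -‿inverseʳ r ⟩
      0# ∎
      where
      r : F
      r = a * D (u ∷ map tail R)

    expand-isAntisymmetric : {D : Form k} → Antisymmetric D → Antisymmetric (expand D)
    expand-isAntisymmetric {D} anti [] (a ∷ u) (b ∷ v) R = begin
      r + - (s + - e)          ≡⟨ cong (r +_) (neg-sub s e) ⟩
      r + (e + - s)            ≡⟨ sym (+-assoc r e (- s)) ⟩
      (r + e) + - s            ≡⟨ cong (λ x → (r + x) + - s) (sym (-‿involutive e)) ⟩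
      (r + - - e) + - s        ≡⟨ cong (λ x → (r + - x) + - s) (sym e′≡-e) ⟩
      (r + - e′) + - s         ≡⟨ sym (neg-sub s (r + - e′)) ⟩
      - (s + - (r + - e′))     ∎
      where
      r s e e′ : F
      r = a * D (v ∷ map tail R)
      s = b * D (u ∷ map tail R)
      e = expand (λ M → D (u ∷ v ∷ M)) R
      e′ = expand (λ M → D (v ∷ u ∷ M)) R
      e′≡-e : e′ ≡ - e
      e′≡-e = ≡-trans (expand-cong (anti [] v u) R) (expand-neg _ R)
    expand-isAntisymmetric {D} anti ((a ∷ u) ∷ L) v w R = begin
      a * D (map tail (L ++ v ∷ w ∷ R)) + - expand (λ M → D (u ∷ M)) (L ++ v ∷ w ∷ R)
        ≡⟨ cong₂ (λ x y → a * x + - y) tails (expand-isAntisymmetric (λ L′ → anti (u ∷ L′)) L v w R) ⟩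
      a * - D (map tail (L ++ w ∷ v ∷ R)) + - - expand (λ M → D (u ∷ M)) (L ++ w ∷ v ∷ R)
        ≡⟨ cong (_+ - - expand (λ M → D (u ∷ M)) (L ++ w ∷ v ∷ R)) (sym (-‿distribʳ-* a _)) ⟩
      - (a * D (map tail (L ++ w ∷ v ∷ R))) + - - expand (λ M → D (u ∷ M)) (L ++ w ∷ v ∷ R)
        ≡⟨ -‿+-comm _ _ ⟩
      - (a * D (map tail (L ++ w ∷ v ∷ R)) + - expand (λ M → D (u ∷ M)) (L ++ w ∷ v ∷ R)) ∎
      where
      tails : D (map tail (L ++ v ∷ w ∷ R)) ≡ - D (map tail (L ++ w ∷ v ∷ R))
      tails rewrite map-++ tail L (v ∷ w ∷ R) | map-++ tail L (w ∷ v ∷ R) = anti (map tail L) _ _ _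

  det-linear : ∀ k → Linear (det k)
  det-linear zero c u v R = sym (≡-trans (+-identityʳ _) (zeroʳ c))
  det-linear (suc k) = expand-isLinear (det-linear k)

  det-alternating : ∀ k → Alternating (det k)
  det-alternating zero u R = refl
  det-alternating (suc k) = expand-isAlternating (det-alternating k)

  det-antisymmetric : ∀ k → Antisymmetric (det k)
  det-antisymmetric zero [] u v R = sym -0#≈0#
  det-antisymmetric zero (_ ∷ L) u v R = sym -0#≈0#
  det-antisymmetric (suc k) = expand-isAntisymmetric (det-antisymmetric k)

  standardBasis : ∀ k → List (Vec F k)
  standardBasis zero = []
  standardBasis (suc k) = (1# ∷ zeros k) ∷ map (0# ∷_) (standardBasis k)

  length-standardBasis : ∀ k → length (standardBasis k) ≡ k
  length-standardBasis zero = refl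
  length-standardBasis (suc k) = cong suc (≡-trans (length-map _ (standardBasis k)) (length-standardBasis k))

  det-standardBasis : ∀ k → det k (standardBasis k) ≡ 1#
  det-standardBasis zero = refl
  det-standardBasis (suc k) = begin
    1# * det k (map tail (map (0# ∷_) B)) + - expand (λ M → det k (zeros k ∷ M)) (map (0# ∷_) B)
      ≡⟨ cong₂ (λ x y → 1# * det k x + - y) (tails B) (heads B) ⟩
    1# * det k B + - 0#
      ≡⟨ cong₂ _+_ (≡-trans (*-identityˡ _) (det-standardBasis k)) -0#≈0# ⟩
    1# + 0#
      ≡⟨ +-identityʳ 1# ⟩
    1# ∎
    where
    B : List (Vec F k)
    B = standardBasis k
    tails : ∀ L → map tail (map (0# ∷_) L) ≡ L
    tails [] = refl
    tails (x ∷ L) = cong (x ∷_) (tails L)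
    heads : ∀ {D : Form k} L → expand D (map (0# ∷_) L) ≡ 0#
    heads [] = refl
    heads (x ∷ L) = ≡-trans (cong₂ (λ e e′ → e + - e′) (zeroˡ _) (heads L))
      (≡-trans (+-identityˡ _) -0#≈0#)

  module AlternatingForm {k : ℕ} {D : Form k} (lin : Linear D) (alt : Alternating D)
      (anti : Antisymmetric D) where

    -- The prefix lets the induction pass under `prep`. One sign serves all prefixes; for the
    -- prefixes `[ s ]` this says that a reordering of `C` affects every determinant of `s ∷ C`
    -- alike.
    signed : ∀ {xs ys} → xs ↭ ys → ∃[ σ ] σ * σ ≡ 1# × (∀ L → D (L ++ xs) ≡ σ * D (L ++ ys))
    signed refl = 1# , *-identityˡ 1# , λ _ → sym (*-identityˡ _)
    signed (prep {xs} {ys} x p) with σ , σσ , eq ← signed p = σ , σσ , λ L →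
      subst (λ M → D M ≡ σ * D (L ++ x ∷ ys)) (++-assoc L [ x ] xs)
        (≡-trans (eq (L ++ [ x ])) (cong (λ M → σ * D M) (++-assoc L [ x ] ys)))
    signed (swap {xs} {ys} x y p) with σ , σσ , eq ← signed p =
      - σ , ≡-trans (≡-trans (sym (-‿distribˡ-* σ _))
          (≡-trans (cong -_ (sym (-‿distribʳ-* σ σ))) (-‿involutive _))) σσ , λ L → begin
        D (L ++ x ∷ y ∷ xs)               ≡⟨ anti L x y xs ⟩
        - D (L ++ y ∷ x ∷ xs)             ≡⟨ cong (λ M → - D M) (sym (++-assoc L (y ∷ [ x ]) xs)) ⟩
        - D ((L ++ y ∷ [ x ]) ++ xs)      ≡⟨ cong -_ (eq (L ++ y ∷ [ x ])) ⟩
        - (σ * D ((L ++ y ∷ [ x ]) ++ ys)) ≡⟨ -‿distribˡ-* σ _ ⟩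
        - σ * D ((L ++ y ∷ [ x ]) ++ ys)  ≡⟨ cong (λ M → - σ * D M) (++-assoc L (y ∷ [ x ]) ys) ⟩
        - σ * D (L ++ y ∷ x ∷ ys)         ∎
    signed (trans p p′) with σ , σσ , eq ← signed p | τ , ττ , eq′ ← signed p′ =
      σ * τ , ≡-trans (Π.interchange σ τ σ τ) (≡-trans (cong₂ _*_ σσ ττ) (*-identityˡ 1#)) , λ L →
        ≡-trans (eq L) (≡-trans (cong (σ *_) (eq′ L)) (sym (*-assoc σ τ _)))

    zero-↭ : ∀ {xs ys} → xs ↭ ys → D ys ≡ 0# → D xs ≡ 0#
    zero-↭ p eq with σ , _ , eq′ ← signed p = ≡-trans (eq′ []) (≡-trans (cong (σ *_) eq) (zeroʳ σ))

    repeated : ∀ {x xs} → x ∈ xs → D (x ∷ xs) ≡ 0#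
    repeated x∈xs with ys , p ← ∈-split x∈xs = zero-↭ (prep _ p) (alt _ ys)

    1⊙ : ∀ {k} (v : Vec F k) → 1# ⊙ v ≡ v
    1⊙ [] = refl
    1⊙ (a ∷ v) = cong₂ _∷_ (*-identityˡ a) (1⊙ v)

    ⊕-zeros : ∀ {k} (v : Vec F k) → v ⊕ zeros k ≡ v
    ⊕-zeros [] = refl
    ⊕-zeros (a ∷ v) = cong₂ _∷_ (+-identityʳ a) (⊕-zeros v)

    zero-vector : ∀ R → D (zeros k ∷ R) ≡ 0#
    zero-vector R = +-cancelˡ (D (zeros k ∷ R)) _ _ (begin
      D (zeros k ∷ R) + D (zeros k ∷ R)       ≡⟨ cong (_+ D (zeros k ∷ R)) (sym (*-identityˡ _)) ⟩
      1# * D (zeros k ∷ R) + D (zeros k ∷ R)  ≡⟨ sym (lin 1# (zeros k) (zeros k) R) ⟩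
      D (1# ⊙ zeros k ⊕ zeros k ∷ R)          ≡⟨ cong (λ v → D (v ∷ R)) (≡-trans (⊕-zeros _) (1⊙ _)) ⟩
      D (zeros k ∷ R)                         ≡⟨ sym (+-identityʳ _) ⟩
      D (zeros k ∷ R) + 0# ∎)

    linear-dot : ∀ cs vs R → D (linearCombination cs vs ∷ R) ≡ dot cs vs (λ v → D (v ∷ R))
    linear-dot [] vs R = zero-vector R
    linear-dot (c ∷ cs) [] R = zero-vector R
    linear-dot (c ∷ cs) (v ∷ vs) R = ≡-trans (lin c v _ R) (cong (_ +_) (linear-dot cs vs R))

    module _ {B : List (Vec F k)} (spans : ∀ v → ∃[ cs ] v ≡ linearCombination cs B) (D[B]≡0 : D B ≡ 0#) where

      -- The vectors of M are exchanged for members of the basis, one at a time.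
      exchange : ∀ M A A′ → B ↭ A ++ A′ → length M ≡ length A′ → D (M ++ A) ≡ 0#
      exchange [] A [] p _ = zero-↭ (subst (_↭ B) (++-identityʳ A) (↭-sym p)) D[B]≡0
      exchange (m ∷ M) A A′ p len with cs , refl ← spans m =
        ≡-trans (linear-dot cs B (M ++ A)) (dot-zero cs B member)
        where
        member : ∀ {b} → b ∈ B → D (b ∷ M ++ A) ≡ 0#
        member {b} b∈B with ∈-++⁻ A (∈-resp-↭ p b∈B)
        ... | inj₁ b∈A = repeated (∈-++⁺ʳ M b∈A)
        ... | inj₂ b∈A′ with A″ , p′ ← ∈-split b∈A′ = zero-↭ (↭-sym (shift b M A))
          (exchange M (b ∷ A) A″ (↭-trans p (↭-trans (++⁺ˡ A p′) (shift b A A″)))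
             (ℕₚ.suc-injective (≡-trans len (↭-length p′))))

      vanishes : ∀ M → length M ≡ length B → D M ≡ 0#
      vanishes M len = subst (λ L → D L ≡ 0#) (++-identityʳ M) (exchange M [] B refl len)

  -- If the determinant vanished on a spanning list, the exchange argument would make it vanish on
  -- the standard basis, where it is one. This avoids multiplicativity of the determinant.
  det≢0 : ∀ {k} (B : List (Vec F k)) → length B ≡ k →
          (∀ v → ∃[ cs ] v ≡ linearCombination cs B) → det k B ≢ 0#
  det≢0 {k} B len spans eq = 1≢0 (≡-trans (sym (det-standardBasis k))
    (vanishes spans eq (standardBasis k) (≡-trans (length-standardBasis k) (sym len))))
    where open AlternatingForm {D = det k} (det-linear k) (det-alternating k) (det-antisymmetric k)

-- Divided differences of polynomials of low degree.

module LagrangeIdentity {q : ℕ} (𝔽 : FiniteField q) where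

  open FieldProperties 𝔽
  open ≡-Reasoning

  θ-neg : ∀ {x} → x ≢ 0# → θ (- x) ≡ - θ x
  θ-neg {x} x≢0 = θ-unique (begin
    - x * - θ x     ≡⟨ sym (-‿distribʳ-* (- x) (θ x)) ⟩
    - (- x * θ x)   ≡⟨ cong -_ (sym (-‿distribˡ-* x (θ x))) ⟩
    - - (x * θ x)   ≡⟨ -‿involutive _ ⟩
    x * θ x         ≡⟨ θ-inverseʳ x≢0 ⟩
    1#              ∎)

  sub≢0 : ∀ {x y} → x ≢ y → x - y ≢ 0#
  sub≢0 {x} {y} x≢y eq = x≢y (+-cancelʳ (- y) x y (≡-trans eq (sym (-‿inverseʳ y))))

  sub-sub : ∀ x y z → (x - y) + (y - z) ≡ x - z
  sub-sub x y z = begin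
    (x + - y) + (y + - z)   ≡⟨ solve 4 (λ x y y′ z′ → (x :+ y′) :+ (y :+ z′) := (y′ :+ y) :+ (x :+ z′)) refl x y
        (- y) (- z) ⟩
    (- y + y) + (x + - z)   ≡⟨ cong (_+ (x - z)) (-‿inverseˡ y) ⟩
    0# + (x + - z)          ≡⟨ +-identityˡ _ ⟩
    x - z                   ∎

  -- For `a` in `E` the factor with `z` equal to `a` drops out, as `θ 0# ≡ 1#`. What is left is, up
  -- to a sign common to all nodes, the term at `a` of the divided difference over `E` of the
  -- polynomial with root list `T`.
  lagrangeTerm : List F → List F → F → F
  lagrangeTerm T E a = ∏ (_- a) T * ∏ (λ z → θ (z - a)) E

  drop-node : ∀ T {e E} → Distinct (e ∷ E) →
    ∑ (λ a → (e - a) * lagrangeTerm T (e ∷ E) a) (e ∷ E) ≡ ∑ (lagrangeTerm T E) E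
  drop-node T {e} {E} (e∉E ∷ _) = begin
    (e - e) * lagrangeTerm T (e ∷ E) e + ∑ (λ a → (e - a) * lagrangeTerm T (e ∷ E) a) E
      ≡⟨ cong₂ _+_ (≡-trans (cong (_* lagrangeTerm T (e ∷ E) e) (-‿inverseʳ e)) (zeroˡ _)) (Σ.big-cong E term) ⟩
    0# + ∑ (lagrangeTerm T E) E
      ≡⟨ +-identityˡ _ ⟩
    ∑ (lagrangeTerm T E) E ∎
    where
    term : ∀ {a} → a ∈ E → (e - a) * lagrangeTerm T (e ∷ E) a ≡ lagrangeTerm T E a
    term {a} a∈E = begin
      (e - a) * (∏ (_- a) T * (θ (e - a) * ∏ (λ z → θ (z - a)) E))
        ≡⟨ solve 4 (λ x t y r → x :* (t :* (y :* r)) := (x :* y) :* (t :* r)) refl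
             (e - a) (∏ (_- a) T) (θ (e - a)) (∏ (λ z → θ (z - a)) E) ⟩
      ((e - a) * θ (e - a)) * lagrangeTerm T E a
        ≡⟨ cong (_* lagrangeTerm T E a) (θ-inverseʳ (sub≢0 (All.lookup e∉E a∈E))) ⟩
      1# * lagrangeTerm T E a
        ≡⟨ *-identityˡ _ ⟩
      lagrangeTerm T E a ∎

  -- Each factor `x - a` is a combination of `e - a` and `e′ - a` with coefficients independent of
  -- `a`. Either of these cancels one node, so the sum reduces to two sums with one root and one
  -- node fewer.
  lagrange : ∀ T E → Distinct E → length E ≡ 2 ℕ.+ length T → ∑ (lagrangeTerm T E) E ≡ 0#
  lagrange [] (e ∷ e′ ∷ []) ((e≢e′ ∷ []) ∷ _) refl = begin
    1# * (θ (e - e) * (θ (e′ - e) * 1#)) + (1# * (θ (e - e′) * (θ (e′ - e′) * 1#)) + 0#)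
      ≡⟨ cong₂ (λ x y → 1# * (x * (θ (e′ - e) * 1#)) + (1# * (θ (e - e′) * (y * 1#)) + 0#)) (θ[x-x] e)
          (θ[x-x] e′) ⟩
    1# * (1# * (θ (e′ - e) * 1#)) + (1# * (θ (e - e′) * (1# * 1#)) + 0#)
      ≡⟨ solve 2 (λ x y → con 1 :* (con 1 :* (x :* con 1)) :+ (con 1 :* (y :* (con 1 :* con 1)) :+ con 0) :=
          x :+ y) refl
           (θ (e′ - e)) (θ (e - e′)) ⟩
    θ (e′ - e) + θ (e - e′)
      ≡⟨ cong (λ x → θ (e′ - e) + θ x) e-e′ ⟩
    θ (e′ - e) + θ (- (e′ - e))
      ≡⟨ cong (θ (e′ - e) +_) (θ-neg (sub≢0 (e≢e′ ∘ sym))) ⟩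
    θ (e′ - e) + - θ (e′ - e)
      ≡⟨ -‿inverseʳ _ ⟩
    0# ∎
    where
    θ[x-x] : ∀ x → θ (x - x) ≡ 1#
    θ[x-x] x = ≡-trans (cong θ (-‿inverseʳ x)) θ-0
    e-e′ : e - e′ ≡ - (e′ - e)
    e-e′ = sym (≡-trans (sym (-‿+-comm e′ (- e))) (≡-trans (+-comm _ _) (cong (_- e′) (-‿involutive e))))
  lagrange (x ∷ T) (e ∷ e′ ∷ E) u@((e≢e′ ∷ e∉E) ∷ e′∉E ∷ uE) len = begin
    ∑ (lagrangeTerm (x ∷ T) N) N
      ≡⟨ Σ.big-cong N (λ {a} _ → term a) ⟩
    ∑ (λ a → lam * ((e - a) * lagrangeTerm T N a) + mu * ((e′ - a) * lagrangeTerm T N a)) N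
      ≡⟨ Σ.big-∙ _ _ N ⟩
    ∑ (λ a → lam * ((e - a) * lagrangeTerm T N a)) N + ∑ (λ a → mu * ((e′ - a) * lagrangeTerm T N a)) N
      ≡⟨ cong₂ _+_ (∑-*ˡ lam _ N) (∑-*ˡ mu _ N) ⟩
    lam * ∑ (λ a → (e - a) * lagrangeTerm T N a) N + mu * ∑ (λ a → (e′ - a) * lagrangeTerm T N a) N
      ≡⟨ cong₂ (λ y z → lam * y + mu * z)
           (≡-trans (drop-node T u) (lagrange T (e′ ∷ E) (e′∉E ∷ uE) len′))
           (≡-trans second (lagrange T (e ∷ E) (e∉E ∷ uE) len′)) ⟩
    lam * 0# + mu * 0#
      ≡⟨ cong₂ _+_ (zeroʳ lam) (zeroʳ mu) ⟩
    0# + 0#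
      ≡⟨ +-identityˡ 0# ⟩
    0# ∎
    where
    N : List F
    N = e ∷ e′ ∷ E
    len′ : suc (length E) ≡ 2 ℕ.+ length T
    len′ = ℕₚ.suc-injective len
    -- The affine coordinates of `x` with respect to `e` and `e′`: `lam` and `mu` add up to one, and
    -- `lam * e + mu * e′` is `x`.
    w mu lam : F
    w = e′ - e
    mu = (x - e) * θ w
    lam = 1# - mu
    combination : ∀ a → lam * (e - a) + mu * (e′ - a) ≡ x - a
    combination a = begin
      lam * (e - a) + mu * (e′ - a)
        ≡⟨ cong (λ y → lam * (e - a) + mu * y) (sym (sub-sub e′ e a)) ⟩
      (1# + - mu) * (e - a) + mu * (w + (e - a))
        ≡⟨ solve 4 (λ m m′ v w → (con 1 :+ m′) :* v :+ m :* (w :+ v) := (m′ :+ m) :* v :+ (m :* w :+ v)) refl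
             mu (- mu) (e - a) w ⟩
      (- mu + mu) * (e - a) + (mu * w + (e - a))
        ≡⟨ cong₂ _+_ (≡-trans (cong (_* (e - a)) (-‿inverseˡ mu)) (zeroˡ _)) (cong (_+ (e - a)) mu*w) ⟩
      0# + ((x - e) + (e - a))
        ≡⟨ +-identityˡ _ ⟩
      (x - e) + (e - a)
        ≡⟨ sub-sub x e a ⟩
      x - a ∎
      where
      mu*w : mu * w ≡ x - e
      mu*w = ≡-trans (*-assoc (x - e) (θ w) w)
        (≡-trans (cong ((x - e) *_) (θ-inverseˡ (sub≢0 (e≢e′ ∘ sym)))) (*-identityʳ _))
    term : ∀ a → lagrangeTerm (x ∷ T) N a ≡ lam * ((e - a) * lagrangeTerm T N a)
        + mu * ((e′ - a) * lagrangeTerm T N a)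
    term a = begin
      ((x - a) * t) * r
        ≡⟨ cong (λ y → (y * t) * r) (sym (combination a)) ⟩
      ((lam * (e - a) + mu * (e′ - a)) * t) * r
        ≡⟨ solve 6 (λ l m y z t r → ((l :* y :+ m :* z) :* t) :* r :=
            l :* (y :* (t :* r)) :+ m :* (z :* (t :* r))) refl
             lam mu (e - a) (e′ - a) t r ⟩
      lam * ((e - a) * (t * r)) + mu * ((e′ - a) * (t * r)) ∎
      where
      t r : F
      t = ∏ (_- a) T
      r = ∏ (λ z → θ (z - a)) N
    second : ∑ (λ a → (e′ - a) * lagrangeTerm T N a) N ≡ ∑ (lagrangeTerm T (e ∷ E)) (e ∷ E)
    second = begin
      ∑ (λ a → (e′ - a) * lagrangeTerm T N a) N
        ≡⟨ Σ.big-↭ _ N↭N′ ⟩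
      ∑ (λ a → (e′ - a) * lagrangeTerm T N a) (e′ ∷ e ∷ E)
        ≡⟨ Σ.big-cong (e′ ∷ e ∷ E) (λ {a} _ → cong (λ y → (e′ - a) * (∏ (_- a) T * y)) (Π.big-↭ _ N↭N′)) ⟩
      ∑ (λ a → (e′ - a) * lagrangeTerm T (e′ ∷ e ∷ E) a) (e′ ∷ e ∷ E)
        ≡⟨ drop-node T (unique-↭ N↭N′ u) ⟩
      ∑ (lagrangeTerm T (e ∷ E)) (e ∷ E) ∎
      where
      N↭N′ : N ↭ e′ ∷ e ∷ E
      N↭N′ = swap e e′ refl

-- The laws of the determinant on `N` vectors of which any `k` form a basis. Vectors are replaced by
-- their indices, whose equality is decidable. The coefficients in `expansion` depend on `x` and the
-- basis only, so they serve every `R`.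
record ArcForm {q : ℕ} (𝔽 : FiniteField q) (k N : ℕ) : Set where
  open FieldProperties 𝔽
  open Multilinear 𝔽 using (dot)
  field
    d : List (Fin N) → F
    signed : ∀ {xs ys} → xs ↭ ys → ∃[ σ ] σ * σ ≡ 1# × (∀ L → d (L ++ xs) ≡ σ * d (L ++ ys))
    antisymmetric : ∀ x y R → d (x ∷ y ∷ R) ≡ - d (y ∷ x ∷ R)
    repeated : ∀ {x xs} → x ∈ xs → d (x ∷ xs) ≡ 0#
    independent : ∀ {xs} → Distinct xs → length xs ≡ k → d xs ≢ 0#
    expansion : ∀ {B} → Distinct B → length B ≡ k → ∀ x → ∃[ cs ] ∀ R → d (x ∷ R) ≡ dot cs B (λ b → d (b ∷ R))

-- The weights of hyperplanes, their symmetry and their linear relations.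

module Weights {q : ℕ} (𝔽 : FiniteField q) {k : ℕ} (𝔸 : ArcForm 𝔽 k (2 ℕ.+ q)) where

  open FieldProperties 𝔽
  open Multilinear 𝔽 using (dot; dot-zero)
  open LagrangeIdentity 𝔽
  open ArcForm 𝔸 public
  open ≡-Reasoning

  I : Set
  I = Fin (2 ℕ.+ q)

  points : List I
  points = allFin (2 ℕ.+ q)

  length-points : length points ≡ 2 ℕ.+ q
  length-points = length-tabulate (λ i → i)

  -- For |Y| = k - 2, the value at a of the tangent function of Y is weight points (a ∷ Y), up to a factor depending
  -- only on Y: on F², the product of the forms det(-, e) over all directions e other than that of the argument is
  -- known.  In this guise Segre's lemma of tangents is the symmetry of the weight in C.
  weight : List I → List I → F
  weight Q C = ∏ (λ s → θ (d (s ∷ C))) Q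

  weight≢0 : ∀ Q C → weight Q C ≢ 0#
  weight≢0 Q C = ∏≢0 _ Q (λ {s} _ → θ≢0 (d (s ∷ C)))

  weight-++ : ∀ Q Q′ C → weight (Q ++ Q′) C ≡ weight Q C * weight Q′ C
  weight-++ Q Q′ C = Π.big-++ _ Q Q′

  weight-⊆ : ∀ {Q C} → Q ⊆ C → weight Q C ≡ 1#
  weight-⊆ {Q} Q⊆C = Π.big-ε Q (λ s∈Q → ≡-trans (cong θ (repeated (Q⊆C s∈Q))) θ-0)

  weight-↭ : ∀ {Q Q′ C} → Q ↭ Q′ → weight Q C ≡ weight Q′ C
  weight-↭ = Π.big-↭ _

  square⇒≢0 : ∀ {σ} → σ * σ ≡ 1# → σ ≢ 0#
  square⇒≢0 σσ refl = 1≢0 (≡-trans (sym σσ) (zeroˡ 0#))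

  weight-symmetric : ∀ {G C C′} → C ↭ C′ → Distinct C → C ⊆ G → Distinct G →
    suc (length C) ≡ k → length G ℕ.+ 3 ≡ k ℕ.+ k → weight (points ++ G) C ≡ weight (points ++ G) C′
  weight-symmetric {G} {C} {C′} p uC C⊆G uG lenC lenG
    with σ , σσ , sign ← signed p
       | H₁ , p₁ ← complement {ys = points} uC (λ {x} _ → ∈-allFin x)
       | H₂ , p₂ ← complement uC C⊆G = begin
    weight (points ++ G) C
      ≡⟨ reduce C (λ c∈C → c∈C) ⟩
    weight (H₁ ++ H₂) C
      ≡⟨ Π.big-cong (H₁ ++ H₂) term ⟩
    ∏ (λ s → σ * θ (d (s ∷ C′))) (H₁ ++ H₂)
      ≡⟨ Π.big-∙ _ _ (H₁ ++ H₂) ⟩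
    ∏ (λ _ → σ) (H₁ ++ H₂) * weight (H₁ ++ H₂) C′
      ≡⟨ cong (_* weight (H₁ ++ H₂) C′) (≡-trans (∏-const σ (H₁ ++ H₂)) σ^len) ⟩
    1# * weight (H₁ ++ H₂) C′
      ≡⟨ *-identityˡ _ ⟩
    weight (H₁ ++ H₂) C′
      ≡⟨ sym (reduce C′ (∈-resp-↭ p)) ⟩
    weight (points ++ G) C′ ∎
    where
    -- `C` occurs once in `points` and once in `G`. Both copies drop out of the weight, since a
    -- repeated vector gives determinant zero and `θ 0# ≡ 1#`.
    split : points ++ G ↭ C ++ (C ++ (H₁ ++ H₂))
    split = ↭-trans (++⁺ p₁ p₂)
        (subst (_↭ C ++ (C ++ (H₁ ++ H₂))) (sym (++-assoc C H₁ (C ++ H₂))) (++⁺ˡ C (shifts H₁ C)))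
    reduce : ∀ C₀ → C ⊆ C₀ → weight (points ++ G) C₀ ≡ weight (H₁ ++ H₂) C₀
    reduce C₀ C⊆C₀ = begin
      weight (points ++ G) C₀                              ≡⟨ weight-↭ split ⟩
      weight (C ++ (C ++ (H₁ ++ H₂))) C₀                   ≡⟨ weight-++ C _ C₀ ⟩
      weight C C₀ * weight (C ++ (H₁ ++ H₂)) C₀            ≡⟨ cong (weight C C₀ *_) (weight-++ C _ C₀) ⟩
      weight C C₀ * (weight C C₀ * weight (H₁ ++ H₂) C₀)
          ≡⟨ cong (λ e → e * (e * weight (H₁ ++ H₂) C₀)) (weight-⊆ C⊆C₀) ⟩
      1# * (1# * weight (H₁ ++ H₂) C₀)                     ≡⟨ ≡-trans (*-identityˡ _) (*-identityˡ _) ⟩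
      weight (H₁ ++ H₂) C₀                                 ∎
    ∉C : ∀ {s} → s ∈ H₁ ++ H₂ → s ∉ C
    ∉C s∈ s∈C with ∈-++⁻ H₁ s∈
    ... | inj₁ s∈H₁ = disjoint C (unique-↭ p₁ (allFin⁺ _)) s∈C s∈H₁
    ... | inj₂ s∈H₂ = disjoint C (unique-↭ p₂ uG) s∈C s∈H₂
    term : ∀ {s} → s ∈ H₁ ++ H₂ → θ (d (s ∷ C)) ≡ σ * θ (d (s ∷ C′))
    term {s} s∈ = begin
      θ (d (s ∷ C))           ≡⟨ cong θ (sign [ s ]) ⟩
      θ (σ * d (s ∷ C′))      ≡⟨ θ-* (square⇒≢0 σσ) (independent
                                   (unique-∷ (∉C s∈ ∘ ∈-resp-↭ (↭-sym p)) (unique-↭ p uC))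
                                   (≡-trans (cong suc (sym (↭-length p))) lenC)) ⟩
      θ σ * θ (d (s ∷ C′))    ≡⟨ cong (_* θ (d (s ∷ C′))) (θ-unique σσ) ⟩
      σ * θ (d (s ∷ C′))      ∎
    len : length (H₁ ++ H₂) ≡ suc q
    len = ℕₚ.+-cancelˡ-≡ (length C ℕ.+ length C ℕ.+ 4) _ _ (begin
      length C ℕ.+ length C ℕ.+ 4 ℕ.+ length (H₁ ++ H₂)
        ≡⟨ cong (λ n → n ℕ.+ length (H₁ ++ H₂)) (ℕₚ.+-comm (length C ℕ.+ length C) 4) ⟩
      4 ℕ.+ (length C ℕ.+ length C ℕ.+ length (H₁ ++ H₂))
        ≡⟨ cong (4 ℕ.+_) (≡-trans (ℕₚ.+-assoc (length C) _ _)
            (sym (≡-trans (length-++ C) (cong (length C ℕ.+_) (length-++ C))))) ⟩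
      4 ℕ.+ length (C ++ (C ++ (H₁ ++ H₂)))
        ≡⟨ cong (4 ℕ.+_) (sym (↭-length split)) ⟩
      4 ℕ.+ length (points ++ G)
        ≡⟨ cong (4 ℕ.+_) (≡-trans (length-++ points) (cong (ℕ._+ length G) length-points)) ⟩
      4 ℕ.+ (2 ℕ.+ q ℕ.+ length G)
        ≡⟨ arith q (length G) ⟩
      (length G ℕ.+ 3) ℕ.+ (3 ℕ.+ q)
        ≡⟨ cong (ℕ._+ (3 ℕ.+ q)) (≡-trans lenG (cong (λ n → n ℕ.+ n) (sym lenC))) ⟩
      (suc (length C) ℕ.+ suc (length C)) ℕ.+ (3 ℕ.+ q)
        ≡⟨ arith′ (length C) q ⟩
      length C ℕ.+ length C ℕ.+ 4 ℕ.+ suc q ∎)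
      where
      arith : ∀ q g → 4 ℕ.+ (2 ℕ.+ q ℕ.+ g) ≡ (g ℕ.+ 3) ℕ.+ (3 ℕ.+ q)
      arith = solve-∀
      arith′ : ∀ c q → (suc c ℕ.+ suc c) ℕ.+ (3 ℕ.+ q) ≡ c ℕ.+ c ℕ.+ 4 ℕ.+ suc q
      arith′ = solve-∀
    σ^len : σ ^ length (H₁ ++ H₂) ≡ 1#
    σ^len = ≡-trans (cong (σ ^_) len) (≡-trans (cong (σ *_) (x^q≡x (square⇒≢0 σσ))) σσ)

  -- The same two scalars must serve every `f` that vanishes on `Y`. A list of coefficients that is
  -- too short is completed by zeros.
  coordinates : ∀ {e e′ : I} {Y} (cs : List F) → ∃₂ λ c c′ → ∀ (f : I → F) →
    (∀ {y} → y ∈ Y → f y ≡ 0#) → dot cs (e ∷ e′ ∷ Y) f ≡ c * f e + c′ * f e′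
  coordinates [] = 0# , 0# , λ f _ →
    sym (≡-trans (cong₂ _+_ (zeroˡ _) (zeroˡ _)) (+-identityˡ 0#))
  coordinates (c ∷ []) = c , 0# , λ f _ → cong (c * f _ +_) (sym (zeroˡ _))
  coordinates {Y = Y} (c ∷ c′ ∷ cs) = c , c′ , λ f f≡0 →
    cong (c * f _ +_) (≡-trans (cong (c′ * f _ +_) (dot-zero cs Y f≡0)) (+-identityʳ _))

  -- The forms through Y live on a plane, with homogeneous coordinates φ and ψ.
  plücker : ∀ {e e′ Y} → Distinct (e ∷ e′ ∷ Y) → 2 ℕ.+ length Y ≡ k → ∀ a w →
    d (e ∷ e′ ∷ Y) * d (a ∷ w ∷ Y) + d (a ∷ e′ ∷ Y) * d (w ∷ e ∷ Y) ≡ d (a ∷ e ∷ Y) * d (w ∷ e′ ∷ Y)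
  plücker {e} {e′} {Y} u len a w
    with cs , expand ← expansion u len a
    with c , c′ , eq ← coordinates {e} {e′} {Y} cs = begin
      Δ * d (a ∷ w ∷ Y) + d (a ∷ e′ ∷ Y) * ψw
        ≡⟨ cong₂ (λ x y → Δ * x + y * ψw) (coord w) φa ⟩
      Δ * (c * d (e ∷ w ∷ Y) + c′ * d (e′ ∷ w ∷ Y)) + (c * Δ) * ψw
        ≡⟨ cong₂ (λ x y → Δ * (c * x + c′ * y) + (c * Δ) * ψw) (antisymmetric e w Y) (antisymmetric e′ w Y) ⟩
      Δ * (c * - ψw + c′ * - φw) + (c * Δ) * ψw
        ≡⟨ solve 6 (λ D c c′ n n′ s → D :* (c :* n :+ c′ :* n′) :+ (c :* D) :* s :=
            c :* D :* (n :+ s) :+ c′ :* (D :* n′)) refl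
             Δ c c′ (- ψw) (- φw) ψw ⟩
      c * Δ * (- ψw + ψw) + c′ * (Δ * - φw)
        ≡⟨ cong₂ _+_ (≡-trans (cong (c * Δ *_) (-‿inverseˡ ψw)) (zeroʳ _))
            (cong (c′ *_) (≡-trans (sym (-‿distribʳ-* Δ φw)) (-‿distribˡ-* Δ φw))) ⟩
      0# + c′ * (- Δ * φw)
        ≡⟨ ≡-trans (+-identityˡ _) (sym (*-assoc c′ _ φw)) ⟩
      c′ * - Δ * φw
        ≡⟨ cong (_* φw) (sym ψa) ⟩
      d (a ∷ e ∷ Y) * φw ∎
    where
    Δ ψw φw : F
    Δ = d (e ∷ e′ ∷ Y)
    ψw = d (w ∷ e ∷ Y)
    φw = d (w ∷ e′ ∷ Y)
    coord : ∀ v → d (a ∷ v ∷ Y) ≡ c * d (e ∷ v ∷ Y) + c′ * d (e′ ∷ v ∷ Y)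
    coord v = ≡-trans (expand (v ∷ Y)) (eq (λ b → d (b ∷ v ∷ Y)) (λ y∈Y → repeated (there y∈Y)))
    φa : d (a ∷ e′ ∷ Y) ≡ c * Δ
    φa = ≡-trans (coord e′) (≡-trans
        (cong (c * Δ +_) (≡-trans (cong (c′ *_) (repeated (here refl))) (zeroʳ c′))) (+-identityʳ _))
    ψa : d (a ∷ e ∷ Y) ≡ c′ * - Δ
    ψa = ≡-trans (coord e) (≡-trans
        (cong₂ (λ x y → c * x + c′ * y) (repeated (here refl)) (antisymmetric e′ e Y))
      (≡-trans (cong (_+ c′ * - Δ) (zeroʳ c)) (+-identityˡ _)))

  -- The pencil of hyperplanes through Y.

  module Plane {Y E rest : List I} {e₀ e′ : I} (p : points ↭ Y ++ e′ ∷ E ++ rest) (e₀∈E : e₀ ∈ E)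
               (lenY : 2 ℕ.+ length Y ≡ k) (lenE : suc (length E) ≡ k) where

    S : List I
    S = E ++ rest

    E⊆S : E ⊆ S
    E⊆S = ∈-++⁺ˡ

    u : Distinct (Y ++ e′ ∷ S)
    u = unique-↭ p (allFin⁺ _)

    u′ : Distinct (e′ ∷ S)
    u′ = unique-++ʳ Y u

    uS : Distinct S
    uS = unique-tail u′

    uY : ∀ {s} → s ∈ e′ ∷ S → Distinct (s ∷ Y)
    uY s∈ = unique-∷ (λ s∈Y → disjoint Y u s∈Y s∈) (unique-++ˡ Y u)

    u₂ : ∀ {s t} → s ∈ S → t ∈ e′ ∷ S → s ≢ t → Distinct (s ∷ t ∷ Y)
    u₂ {s} {t} s∈ t∈ s≢t = unique-∷ s∉ (uY t∈)
      where
      s∉ : s ∉ t ∷ Y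
      s∉ (here s≡t) = s≢t s≡t
      s∉ (there s∈Y) = disjoint Y u s∈Y (there s∈)

    S≢e′ : ∀ {s} → s ∈ S → s ≢ e′
    S≢e′ s∈ refl = Unique[x∷xs]⇒x∉xs u′ s∈

    -- `c` is an affine coordinate on the projective line of directions modulo `Y`, with `e₀` at
    -- zero and `e′` at infinity. Since `e′` lies outside `E`, every node of the interpolation is
    -- finite.
    φ ψ c : I → F
    φ s = d (s ∷ e′ ∷ Y)
    ψ s = d (s ∷ e₀ ∷ Y)
    c s = ψ s * θ (φ s)

    Δ : F
    Δ = φ e₀

    φ≢0 : ∀ {s} → s ∈ S → φ s ≢ 0#
    φ≢0 s∈ = independent (u₂ s∈ (here refl) (S≢e′ s∈)) lenY

    d≢0 : ∀ {s t} → s ∈ S → t ∈ S → s ≢ t → d (s ∷ t ∷ Y) ≢ 0#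
    d≢0 s∈ t∈ s≢t = independent (u₂ s∈ (there t∈) s≢t) lenY

    cφ : ∀ {s} → s ∈ S → c s * φ s ≡ ψ s
    cφ {s} s∈ = ≡-trans (*-assoc _ _ _) (≡-trans (cong (ψ s *_) (θ-inverseˡ (φ≢0 s∈))) (*-identityʳ _))

    -- This is the Plücker relation with `ψ` replaced by `c` times `φ`: up to factors in `s` and `t`
    -- separately, the determinant is a difference of affine coordinates.
    form : ∀ {s t} → s ∈ S → t ∈ S → Δ * d (s ∷ t ∷ Y) ≡ φ s * φ t * (c s - c t)
    form {s} {t} s∈ t∈ = +-cancelʳ (φ s * ψ t) _ _ (begin
      Δ * d (s ∷ t ∷ Y) + φ s * ψ t
        ≡⟨ plücker (u₂ (E⊆S e₀∈E) (here refl) (S≢e′ (E⊆S e₀∈E))) lenY s t ⟩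
      ψ s * φ t
        ≡⟨ cong (_* φ t) (sym (cφ s∈)) ⟩
      c s * φ s * φ t
        ≡⟨ sym (+-identityʳ _) ⟩
      c s * φ s * φ t + 0#
        ≡⟨ cong (c s * φ s * φ t +_) (sym (≡-trans (cong (φ s * φ t *_) (-‿inverseˡ (c t))) (zeroʳ _))) ⟩
      c s * φ s * φ t + φ s * φ t * (- c t + c t)
        ≡⟨ solve 5 (λ x y a b b′ → a :* x :* y :+ x :* y :* (b′ :+ b) :=
            x :* y :* (a :+ b′) :+ x :* (b :* y)) refl
             (φ s) (φ t) (c s) (c t) (- c t) ⟩
      φ s * φ t * (c s - c t) + φ s * (c t * φ t)
        ≡⟨ cong (λ x → φ s * φ t * (c s - c t) + φ s * x) (cφ t∈) ⟩
      φ s * φ t * (c s - c t) + φ s * ψ t ∎)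

    Δ≢0 : Δ ≢ 0#
    Δ≢0 = φ≢0 (E⊆S e₀∈E)

    c-injective : ∀ {s t} → s ∈ S → t ∈ S → c s ≡ c t → s ≡ t
    c-injective {s} {t} s∈ t∈ eq with s ≟ t
    ... | yes s≡t = s≡t
    ... | no s≢t = contradiction
      (≡-trans (form s∈ t∈) (≡-trans
          (cong (φ s * φ t *_) (≡-trans (cong (λ x → x - c t) eq) (-‿inverseʳ (c t)))) (zeroʳ _)))
      (*-nonZero Δ≢0 (d≢0 s∈ t∈ s≢t))

    θ-form : ∀ {s t} → s ∈ S → t ∈ S → s ≢ t →
      θ (d (s ∷ t ∷ Y)) ≡ Δ * θ (φ t) * (θ (φ s) * θ (c s - c t))
    θ-form {s} {t} s∈ t∈ s≢t = *-cancelˡ-nonZero (θ≢0 Δ) (begin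
      θ Δ * θ (d (s ∷ t ∷ Y))
        ≡⟨ sym (θ-* Δ≢0 (d≢0 s∈ t∈ s≢t)) ⟩
      θ (Δ * d (s ∷ t ∷ Y))
        ≡⟨ cong θ (form s∈ t∈) ⟩
      θ (φ s * φ t * (c s - c t))
        ≡⟨ θ-* (*-nonZero (φ≢0 s∈) (φ≢0 t∈)) (sub≢0 (s≢t ∘ c-injective s∈ t∈)) ⟩
      θ (φ s * φ t) * θ (c s - c t)
        ≡⟨ cong (_* θ (c s - c t)) (θ-* (φ≢0 s∈) (φ≢0 t∈)) ⟩
      θ (φ s) * θ (φ t) * θ (c s - c t)
        ≡⟨ sym (*-identityˡ _) ⟩
      1# * (θ (φ s) * θ (φ t) * θ (c s - c t))
        ≡⟨ cong (_* (θ (φ s) * θ (φ t) * θ (c s - c t))) (sym (θ-inverseˡ Δ≢0)) ⟩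
      θ Δ * Δ * (θ (φ s) * θ (φ t) * θ (c s - c t))
        ≡⟨ solve 5 (λ D′ D x y z → D′ :* D :* (x :* y :* z) := D′ :* (D :* y :* (x :* z))) refl
             (θ Δ) Δ (θ (φ s)) (θ (φ t)) (θ (c s - c t)) ⟩
      θ Δ * (Δ * θ (φ t) * (θ (φ s) * θ (c s - c t))) ∎)

    -- `T` collects the finite directions that no vector takes; they are the roots of the tangent
    -- function of `Y`.
    tangents : ∃[ T ] elements ↭ map c S ++ T
    tangents = complement (unique-map c-injective uS) (λ {x} _ → ∈-allFin x)

    T : List F
    T = proj₁ tangents

    length-S : length S ℕ.+ length T ≡ q
    length-S = sym (begin
      q                                ≡⟨ sym (length-tabulate (λ i → i)) ⟩
      length elements                  ≡⟨ ↭-length (proj₂ tangents) ⟩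
      length (map c S ++ T)            ≡⟨ length-++ (map c S) ⟩
      length (map c S) ℕ.+ length T    ≡⟨ cong (ℕ._+ length T) (length-map c S) ⟩
      length S ℕ.+ length T            ∎)

    -- `Y`, `e′` and `S` exhaust the q + 2 points, so `S` has q + 3 - k members and `T` has k - 3.
    -- This is the number of nodes that `lagrange` asks for.
    length-E : length E ≡ 2 ℕ.+ length T
    length-E = ℕₚ.suc-injective (ℕₚ.+-cancelˡ-≡ (length S) _ _ (begin
      length S ℕ.+ suc (length E)            ≡⟨ cong (length S ℕ.+_) (≡-trans lenE (sym lenY)) ⟩
      length S ℕ.+ (2 ℕ.+ length Y)          ≡⟨ arith (length S) (length Y) ⟩
      suc (length Y ℕ.+ suc (length S))      ≡⟨ cong suc (sym (length-++ Y)) ⟩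
      suc (length (Y ++ e′ ∷ S))             ≡⟨ cong suc (sym (↭-length p)) ⟩
      suc (length points)                    ≡⟨ cong suc length-points ⟩
      3 ℕ.+ q                                ≡⟨ cong (3 ℕ.+_) (sym length-S) ⟩
      3 ℕ.+ (length S ℕ.+ length T)          ≡⟨ arith′ (length S) (length T) ⟩
      length S ℕ.+ suc (2 ℕ.+ length T)      ∎))
      where
      arith : ∀ s y → s ℕ.+ (2 ℕ.+ y) ≡ suc (y ℕ.+ suc s)
      arith = solve-∀
      arith′ : ∀ s t → 3 ℕ.+ (s ℕ.+ t) ≡ s ℕ.+ suc (2 ℕ.+ t)
      arith′ = solve-∀

    Ω K : F
    Ω = ∏ θ elements
    K = ∏ (θ ∘ φ) (S ++ E)

    θc : I → List I → F
    θc a Q = ∏ (λ s → θ (c s - c a)) Q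

    -- Over the whole field the product is `Ω` by translation, and `c` maps `S` onto the complement
    -- of `T`. Dividing by the factors that belong to `T` turns inverses into the values `t - c a`.
    θc-S : ∀ {a} → a ∈ S → θc a S ≡ Ω * ∏ (_- c a) T
    θc-S {a} a∈S = begin
      θc a S
        ≡⟨ sym (*-identityʳ _) ⟩
      θc a S * 1#
        ≡⟨ cong (θc a S *_) (sym (Π.big-ε T (λ t∈T → θ-inverseˡ (sub≢0 (T∌c t∈T))))) ⟩
      θc a S * ∏ (λ t → θ (t - c a) * (t - c a)) T
        ≡⟨ cong (θc a S *_) (Π.big-∙ _ _ T) ⟩
      θc a S * (∏ (λ t → θ (t - c a)) T * ∏ (_- c a) T)
        ≡⟨ sym (*-assoc _ _ _) ⟩
      θc a S * ∏ (λ t → θ (t - c a)) T * ∏ (_- c a) T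
        ≡⟨ cong (_* ∏ (_- c a) T) (begin
             θc a S * ∏ (λ t → θ (t - c a)) T
                 ≡⟨ cong (_* ∏ (λ t → θ (t - c a)) T) (sym (Π.big-map _ c S)) ⟩
             ∏ (λ t → θ (t - c a)) (map c S) * ∏ (λ t → θ (t - c a)) T ≡⟨ sym (Π.big-++ _ (map c S) T) ⟩
             ∏ (λ t → θ (t - c a)) (map c S ++ T)            ≡⟨ sym (Π.big-↭ _ (proj₂ tangents)) ⟩
             ∏ (λ t → θ (t - c a)) elements                  ≡⟨ ∏-translate θ (- c a) ⟩
             Ω ∎) ⟩
      Ω * ∏ (_- c a) T ∎
      where
      T∌c : ∀ {t} → t ∈ T → t ≢ c a
      T∌c t∈T refl = disjoint (map c S) (unique-↭ (proj₂ tangents) (allFin⁺ q)) (∈-map⁺ c a∈S) t∈T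

    -- In the affine coordinate the weight becomes the value of the tangent polynomial at `c a`,
    -- divided by the differences of nodes. Everything else is made independent of `a`.
    weight-factors : ∀ {a} → a ∈ E → weight (points ++ Y ++ E) (a ∷ Y)
        ≡ - Δ * K * Ω * lagrangeTerm T (map c E) (c a)
    weight-factors {a} a∈E with E₁ , pE ← ∈-split a∈E | S₁ , pS ← ∈-split (E⊆S a∈E) = begin
      weight (points ++ Y ++ E) (a ∷ Y)
        ≡⟨ ≡-trans (weight-++ points (Y ++ E) (a ∷ Y)) (cong₂ _*_ (weight-↭ p) (weight-++ Y E (a ∷ Y))) ⟩
      weight (Y ++ e′ ∷ S) (a ∷ Y) * (weight Y (a ∷ Y) * weight E (a ∷ Y))
        ≡⟨ cong₂ (λ x y → x * (y * weight E (a ∷ Y))) (weight-++ Y (e′ ∷ S) (a ∷ Y))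
            (weight-⊆ {Y} {a ∷ Y} there) ⟩
      weight Y (a ∷ Y) * (θ (d (e′ ∷ a ∷ Y)) * weight S (a ∷ Y)) * (1# * weight E (a ∷ Y))
        ≡⟨ cong₂ (λ x y → x * (y * weight S (a ∷ Y)) * (1# * weight E (a ∷ Y))) (weight-⊆ {Y} {a ∷ Y} there)
            θe′ ⟩
      1# * (- θ (φ a) * weight S (a ∷ Y)) * (1# * weight E (a ∷ Y))
        ≡⟨ solve 3 (λ f s e → con 1 :* (f :* s) :* (con 1 :* e) := f :* (s :* e)) refl (- θ (φ a))
            (weight S (a ∷ Y)) (weight E (a ∷ Y)) ⟩
      - θ (φ a) * (weight S (a ∷ Y) * weight E (a ∷ Y))
        ≡⟨ cong (- θ (φ a) *_) (sym (weight-++ S E (a ∷ Y))) ⟩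
      - θ (φ a) * weight (S ++ E) (a ∷ Y)
        ≡⟨ cong (- θ (φ a) *_) ∏d ⟩
      - θ (φ a) * (Δ * θ (φ a) * (∏ (θ ∘ φ) Q * θc a Q))
        ≡⟨ solve 5 (λ m f D P R → m :* (D :* f :* (P :* R)) := (m :* D) :* (f :* P) :* R) refl
             (- θ (φ a)) (θ (φ a)) Δ (∏ (θ ∘ φ) Q) (θc a Q) ⟩
      (- θ (φ a) * Δ) * (θ (φ a) * ∏ (θ ∘ φ) Q) * θc a Q
        ≡⟨ cong (λ x → x * (θ (φ a) * ∏ (θ ∘ φ) Q) * θc a Q)
             (≡-trans (sym (-‿distribˡ-* (θ (φ a)) Δ))
                 (≡-trans (cong -_ (*-comm (θ (φ a)) Δ)) (-‿distribˡ-* Δ (θ (φ a))))) ⟩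
      -- One factor `θ (φ a)` stems from `e′`, the other from the power collapsed by Fermat. They
      -- fill the two places of `a` in `K`, one as a member of `S` and one as a member of `E`.
      (- Δ * θ (φ a)) * (θ (φ a) * ∏ (θ ∘ φ) Q) * θc a Q
        ≡⟨ cong₂ (λ x y → x * y) (*-assoc (- Δ) (θ (φ a)) _) (sym θc-Q) ⟩
      - Δ * ∏ (θ ∘ φ) (a ∷ a ∷ Q) * θc a (S ++ E)
        ≡⟨ cong₂ (λ x y → - Δ * x * y) (sym (Π.big-↭ (θ ∘ φ) SE)) (Π.big-++ _ S E) ⟩
      - Δ * K * (θc a S * θc a E)
        ≡⟨ cong₂ (λ x y → - Δ * K * (x * y)) (θc-S (E⊆S a∈E)) (sym (Π.big-map _ c E)) ⟩
      - Δ * K * (Ω * ∏ (_- c a) T * ∏ (λ z → θ (z - c a)) (map c E))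
        ≡⟨ solve 5 (λ D K O x y → D :* K :* (O :* x :* y) := D :* K :* O :* (x :* y)) refl
             (- Δ) K Ω (∏ (_- c a) T) (∏ (λ z → θ (z - c a)) (map c E)) ⟩
      - Δ * K * Ω * lagrangeTerm T (map c E) (c a) ∎
      where
      a∈S : a ∈ S
      a∈S = E⊆S a∈E
      θe′ : θ (d (e′ ∷ a ∷ Y)) ≡ - θ (φ a)
      θe′ = ≡-trans (cong θ (antisymmetric e′ a Y)) (θ-neg (φ≢0 a∈S))
      Q : List I
      Q = S₁ ++ E₁
      SE : S ++ E ↭ a ∷ a ∷ Q
      SE = ↭-trans (++⁺ pS pE) (prep a (shift a S₁ E₁))
      a≢ : ∀ {xs xs₁ s} → xs ↭ a ∷ xs₁ → Distinct xs → s ∈ xs₁ → s ≢ a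
      a≢ r un s∈ refl = Unique[x∷xs]⇒x∉xs (unique-↭ r un) s∈
      inQ : ∀ {s} → s ∈ Q → s ∈ S × s ≢ a
      inQ s∈ with ∈-++⁻ S₁ s∈
      ... | inj₁ s∈S₁ = ∈-resp-↭ (↭-sym pS) (there s∈S₁) , a≢ pS uS s∈S₁
      ... | inj₂ s∈E₁ = E⊆S (∈-resp-↭ (↭-sym pE) (there s∈E₁)) , a≢ pE (unique-++ˡ E uS) s∈E₁
      length-Q : length Q ≡ q
      length-Q = ℕₚ.suc-injective (ℕₚ.suc-injective (begin
        2 ℕ.+ length Q                        ≡⟨ sym (↭-length SE) ⟩
        length (S ++ E)                       ≡⟨ length-++ S ⟩
        length S ℕ.+ length E                 ≡⟨ cong (length S ℕ.+_) length-E ⟩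
        length S ℕ.+ (2 ℕ.+ length T)         ≡⟨ ≡-trans (ℕₚ.+-suc _ _) (cong suc (ℕₚ.+-suc _ _)) ⟩
        2 ℕ.+ (length S ℕ.+ length T)         ≡⟨ cong (2 ℕ.+_) length-S ⟩
        2 ℕ.+ q                               ∎))
      ∏d : weight (S ++ E) (a ∷ Y) ≡ Δ * θ (φ a) * (∏ (θ ∘ φ) Q * θc a Q)
      ∏d = begin
        weight (S ++ E) (a ∷ Y)
          ≡⟨ weight-↭ SE ⟩
        θ (d (a ∷ a ∷ Y)) * (θ (d (a ∷ a ∷ Y)) * weight Q (a ∷ Y))
          ≡⟨ cong (λ x → x * (x * weight Q (a ∷ Y))) (≡-trans (cong θ (repeated (here refl))) θ-0) ⟩
        1# * (1# * weight Q (a ∷ Y))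
          ≡⟨ ≡-trans (*-identityˡ _) (*-identityˡ _) ⟩
        weight Q (a ∷ Y)
          ≡⟨ Π.big-cong Q (λ s∈Q → θ-form (proj₁ (inQ s∈Q)) a∈S (proj₂ (inQ s∈Q))) ⟩
        ∏ (λ s → Δ * θ (φ a) * (θ (φ s) * θ (c s - c a))) Q
          ≡⟨ ≡-trans (Π.big-∙ _ _ Q) (cong₂ _*_ (∏-const _ Q) (Π.big-∙ _ _ Q)) ⟩
        -- `Q` has exactly `q` members, so the power equals its base.
        (Δ * θ (φ a)) ^ length Q * (∏ (θ ∘ φ) Q * θc a Q)
          ≡⟨ cong (_* (∏ (θ ∘ φ) Q * θc a Q))
              (≡-trans (cong ((Δ * θ (φ a)) ^_) length-Q) (x^q≡x (*-nonZero Δ≢0 (θ≢0 (φ a))))) ⟩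
        Δ * θ (φ a) * (∏ (θ ∘ φ) Q * θc a Q) ∎
      θc-Q : θc a (S ++ E) ≡ θc a Q
      θc-Q = begin
        θc a (S ++ E)                                 ≡⟨ Π.big-↭ _ SE ⟩
        θ (c a - c a) * (θ (c a - c a) * θc a Q)
            ≡⟨ cong (λ x → x * (x * θc a Q)) (≡-trans (cong θ (-‿inverseʳ (c a))) θ-0) ⟩
        1# * (1# * θc a Q)                            ≡⟨ ≡-trans (*-identityˡ _) (*-identityˡ _) ⟩
        θc a Q                                        ∎

    ∑-weight : ∑ (λ a → weight (points ++ Y ++ E) (a ∷ Y)) E ≡ 0#
    ∑-weight = begin
      ∑ (λ a → weight (points ++ Y ++ E) (a ∷ Y)) E
        ≡⟨ Σ.big-cong E weight-factors ⟩
      ∑ (λ a → - Δ * K * Ω * lagrangeTerm T (map c E) (c a)) E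
        ≡⟨ ∑-*ˡ (- Δ * K * Ω) _ E ⟩
      - Δ * K * Ω * ∑ (λ a → lagrangeTerm T (map c E) (c a)) E
        ≡⟨ cong (- Δ * K * Ω *_) (sym (Σ.big-map (lagrangeTerm T (map c E)) c E)) ⟩
      - Δ * K * Ω * ∑ (lagrangeTerm T (map c E)) (map c E)
        ≡⟨ cong (- Δ * K * Ω *_) (lagrange T (map c E)
             (unique-map (λ x∈ y∈ → c-injective (E⊆S x∈) (E⊆S y∈)) (unique-++ˡ E uS))
                 (≡-trans (length-map c E) length-E)) ⟩
      - Δ * K * Ω * 0#
        ≡⟨ zeroʳ _ ⟩
      0# ∎

  -- The bound guarantees that `Y` and `E`, which have 2k - 3 members together, leave at least one
  -- of the q + 2 points to be placed at infinity.
  interpolation : ∀ {Y E} → Distinct (Y ++ E) → 2 ℕ.+ length Y ≡ k → suc (length E) ≡ k → k ℕ.+ k ℕ.≤ 4 ℕ.+ q →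
    ∑ (λ a → weight (points ++ Y ++ E) (a ∷ Y)) E ≡ 0#
  interpolation {Y} {[]} u lenY lenE _ = refl
  interpolation {Y} {e ∷ E} u lenY lenE bound with complement {ys = points} u (λ {x} _ → ∈-allFin x)
  ... | e′ ∷ rest , p = Plane.∑-weight {rest = rest} {e₀ = e}
      (↭-trans p (↭-trans (shift e′ (Y ++ e ∷ E) rest)
      (↭-trans (prep e′ assoc↭) (↭-sym (shift e′ Y ((e ∷ E) ++ rest)))))) (here refl) lenY lenE
    where
    assoc↭ : (Y ++ e ∷ E) ++ rest ↭ Y ++ (e ∷ E) ++ rest
    assoc↭ = subst (_↭ Y ++ (e ∷ E) ++ rest) (sym (++-assoc Y (e ∷ E) rest)) refl
  ... | [] , p = contradiction bound (ℕₚ.<⇒≱ (ℕₚ.≤-reflexive (sym eq)))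
    where
    eq : k ℕ.+ k ≡ 5 ℕ.+ q
    eq = begin
      k ℕ.+ k                                    ≡⟨ cong₂ ℕ._+_ (sym lenY) (sym lenE) ⟩
      2 ℕ.+ length Y ℕ.+ suc (suc (length E))    ≡⟨ arith (length Y) (length E) ⟩
      3 ℕ.+ (length Y ℕ.+ suc (length E))        ≡⟨ cong (3 ℕ.+_) (sym (length-++ Y)) ⟩
      3 ℕ.+ length (Y ++ e ∷ E)
          ≡⟨ cong (3 ℕ.+_) (sym (cong length (++-identityʳ (Y ++ e ∷ E)))) ⟩
      3 ℕ.+ length ((Y ++ e ∷ E) ++ [])          ≡⟨ cong (3 ℕ.+_) (sym (↭-length p)) ⟩
      3 ℕ.+ length points                        ≡⟨ cong (3 ℕ.+_) length-points ⟩
      5 ℕ.+ q                                    ∎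
      where
      arith : ∀ y e → 2 ℕ.+ y ℕ.+ suc (suc e) ≡ 3 ℕ.+ (y ℕ.+ suc e)
      arith = solve-∀

-- The linear system of subset inclusions, and alternating sums over pairs.

module InclusionSystem {q : ℕ} (𝔽 : FiniteField q) {I : Set} where

  open FieldProperties 𝔽
  open SemiringMult semiring using () renaming (_×_ to _·_)
  open ≡-Reasoning

  Symmetric : (List I → F) → Set
  Symmetric b = ∀ {C C′} → C ↭ C′ → b C ≡ b C′

  SumsVanish : ℕ → List I → (List I → F) → Set
  SumsVanish r G b = ∀ Y E → Y ++ E ↭ G → suc (length Y) ≡ r → ∑ (λ a → b (a ∷ Y)) E ≡ 0#

  module Inversion {b : List I → F} (b-sym : Symmetric b) where

    -- With lists read as sets, this sums `b` over the sets that contain `A` and have `j` further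
    -- members, all from `L`; elements outside `A` and `L` are forbidden.
    sublistSum : ℕ → List I → List I → F
    sublistSum zero L A = b A
    sublistSum (suc j) [] A = 0#
    sublistSum (suc j) (x ∷ L) A = sublistSum j L (x ∷ A) + sublistSum (suc j) L A

    sublistSum-↭ : ∀ j L {A A′} → A ↭ A′ → sublistSum j L A ≡ sublistSum j L A′
    sublistSum-↭ zero L p = b-sym p
    sublistSum-↭ (suc j) [] p = refl
    sublistSum-↭ (suc j) (x ∷ L) p = cong₂ _+_ (sublistSum-↭ j L (prep x p)) (sublistSum-↭ (suc j) L p)

    sublistSum-1 : ∀ L A → sublistSum 1 L A ≡ ∑ (λ a → b (a ∷ A)) L
    sublistSum-1 [] A = refl
    sublistSum-1 (x ∷ L) A = cong (b (x ∷ A) +_) (sublistSum-1 L A)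

    sublistSum-short : ∀ j L A → length L ℕ.< j → sublistSum j L A ≡ 0#
    sublistSum-short (suc j) [] A _ = refl
    sublistSum-short (suc j) (x ∷ L) A (ℕ.s≤s len) =
      ≡-trans (cong₂ _+_ (sublistSum-short j L (x ∷ A) len) (sublistSum-short (suc j) L A (ℕₚ.m≤n⇒m≤1+n len)))
          (+-identityˡ 0#)

    sublistSum-full : ∀ V A → sublistSum (length V) V A ≡ b (V ++ A)
    sublistSum-full [] A = refl
    sublistSum-full (x ∷ V) A = ≡-trans
      (cong₂ _+_ (≡-trans (sublistSum-full V (x ∷ A)) (b-sym (shift x V A)))
          (sublistSum-short (suc (length V)) V A ℕₚ.≤-refl))
      (+-identityʳ _)

    picks : List I → List (I × List I)
    picks [] = []
    picks (x ∷ L) = (x , L) ∷ map (λ (y , M) → y , x ∷ M) (picks L)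

    picks-↭ : ∀ {L z} → z ∈ picks L → L ↭ proj₁ z ∷ proj₂ z
    picks-↭ {x ∷ L} (here refl) = refl
    picks-↭ {x ∷ L} (there z∈) with (y , M) , z′∈ , refl ← ∈-map⁻ _ z∈ =
      ↭-trans (prep x (picks-↭ z′∈)) (swap x y refl)

    -- Each (j + 1)-sublist is counted once for each of its members.
    ∑-picks : ∀ j L A → ∑ (λ (x , M) → sublistSum j M (x ∷ A)) (picks L) ≡ (suc j · 1#) * sublistSum (suc j) L A
    ∑-picks j [] A = sym (zeroʳ _)
    ∑-picks zero (y ∷ L) A = begin
      b (y ∷ A) + ∑ (λ (x , M) → b (x ∷ A)) (map _ (picks L))
        ≡⟨ cong (b (y ∷ A) +_) (≡-trans (Σ.big-map _ _ (picks L)) (∑-picks zero L A)) ⟩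
      b (y ∷ A) + (1# + 0#) * s
        ≡⟨ solve 2 (λ x s → x :+ (con 1 :+ con 0) :* s := (con 1 :+ con 0) :* (x :+ s)) refl (b (y ∷ A)) s ⟩
      (1# + 0#) * (b (y ∷ A) + s) ∎
      where
      s : F
      s = sublistSum 1 L A
    ∑-picks (suc j) (y ∷ L) A = begin
      t + ∑ (λ (x , M) → sublistSum (suc j) M (x ∷ A)) (map _ (picks L))
        ≡⟨ cong (t +_) (≡-trans (Σ.big-map _ _ (picks L)) (Σ.big-∙ _ _ (picks L))) ⟩
      t + (∑ (λ (x , M) → sublistSum j M (y ∷ x ∷ A)) (picks L)
          + ∑ (λ (x , M) → sublistSum (suc j) M (x ∷ A)) (picks L))
        ≡⟨ cong₂ (λ u v → t + (u + v))
             (≡-trans (Σ.big-cong (picks L) (λ {z} _ → sublistSum-↭ j (proj₂ z) (swap y (proj₁ z) refl)))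
                 (∑-picks j L (y ∷ A)))
             (∑-picks (suc j) L A) ⟩
      t + ((1# + n) * t + (1# + (1# + n)) * s)
        ≡⟨ solve 3 (λ t n s → t :+ ((con 1 :+ n) :* t :+ (con 1 :+ (con 1 :+ n)) :* s) :=
            (con 1 :+ (con 1 :+ n)) :* (t :+ s)) refl t n s ⟩
      (1# + (1# + n)) * (t + s) ∎
      where
      t s n : F
      t = sublistSum (suc j) L (y ∷ A)
      s = sublistSum (suc (suc j)) L A
      n = j · 1#

    module _ {r : ℕ} {G : List I} (invertible : ∀ {j} → 0 ℕ.< j → j ℕ.≤ r → j · 1# ≢ 0#)
        (rel : SumsVanish r G b) where

      -- Descent on the size of `A`, from r - 1 where it is the hypothesis. Summing over all ways to
      -- enlarge `A` by one element counts each set r - |A| times, and that integer is invertible.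
      supersets-vanish : ∀ j L A → A ++ L ↭ G → length A ℕ.+ suc j ≡ r → sublistSum (suc j) L A ≡ 0#
      supersets-vanish zero L A p len = ≡-trans (sublistSum-1 L A)
        (rel A L p (≡-trans (≡-trans (cong suc (sym (ℕₚ.+-identityʳ _))) (sym (ℕₚ.+-suc _ 0))) len))
      supersets-vanish (suc j) L A p len = a*b≡0⇒b≡0
        (invertible (ℕ.s≤s ℕ.z≤n) (subst (2 ℕ.+ j ℕ.≤_) len (ℕₚ.m≤n+m _ (length A))))
        (≡-trans (sym (∑-picks (suc j) L A)) (Σ.big-ε (picks L) (λ {z} z∈ →
          supersets-vanish j (proj₂ z) (proj₁ z ∷ A)
            (↭-trans (↭-sym (shift (proj₁ z) A (proj₂ z))) (↭-trans (++⁺ˡ A (↭-sym (picks-↭ z∈))) p))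
            (≡-trans (sym (ℕₚ.+-suc (length A) _)) len))))

      -- Inclusion and exclusion over `B`: the sets avoiding `x` are all sets less those containing
      -- `x`. Each exclusion may move one element into `A`, and the bound on `B` leaves at least one
      -- element still to be chosen.
      avoiding-vanish : ∀ j B L A → A ++ B ++ L ↭ G → length A ℕ.+ suc j ≡ r → length B ℕ.≤ j →
          sublistSum (suc j) L A ≡ 0#
      avoiding-vanish j [] L A p len _ = supersets-vanish j L A p len
      avoiding-vanish (suc j) (x ∷ B) L A p len (ℕ.s≤s lenB) = begin
        sublistSum (2 ℕ.+ j) L A
          ≡⟨ sym (+-identityˡ _) ⟩
        0# + sublistSum (2 ℕ.+ j) L A
          ≡⟨ cong (_+ sublistSum (2 ℕ.+ j) L A)
              (sym (avoiding-vanish j B L (x ∷ A) (↭-trans (↭-sym (shift x A (B ++ L))) p)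
               (≡-trans (sym (ℕₚ.+-suc (length A) _)) len) lenB)) ⟩
        sublistSum (suc j) L (x ∷ A) + sublistSum (2 ℕ.+ j) L A
          ≡⟨ avoiding-vanish (suc j) B (x ∷ L) A (↭-trans (++⁺ˡ A (shift x B L)) p) len (ℕₚ.m≤n⇒m≤1+n lenB) ⟩
        0# ∎

      -- The inclusion matrix of (r - 1)-subsets in r-subsets of a (2r - 1)-set is invertible.
      inversion : ∀ V B → V ++ B ↭ G → length V ≡ r → suc (length B) ≡ r → b V ≡ 0#
      inversion V B p lenV lenB = begin
        b V                          ≡⟨ cong b (sym (++-identityʳ V)) ⟩
        -- The only r-set that avoids `B`, the complement of `V`, is `V` itself.
        b (V ++ [])                  ≡⟨ sym (sublistSum-full V []) ⟩
        sublistSum (length V) V []   ≡⟨ cong (λ n → sublistSum n V []) (≡-trans lenV (sym lenB)) ⟩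
        sublistSum (suc (length B)) V []
            ≡⟨ avoiding-vanish (length B) B V [] (↭-trans (++-comm B V) p) lenB ℕₚ.≤-refl ⟩
        0#                           ∎

  alternate : (List I → F) → List (I × I) → List I → F
  alternate f [] V = f V
  alternate f ((x , y) ∷ P) V = alternate f P (x ∷ V) + - alternate f P (y ∷ V)

  flatten : List (I × I) → List I
  flatten [] = []
  flatten ((x , y) ∷ P) = x ∷ y ∷ flatten P

  alternate-symmetric : ∀ {b} → Symmetric b → ∀ P → Symmetric (alternate b P)
  alternate-symmetric b-sym [] p = b-sym p
  alternate-symmetric b-sym ((x , y) ∷ P) p =
    cong₂ (λ u v → u + - v) (alternate-symmetric b-sym P (prep x p)) (alternate-symmetric b-sym P (prep y p))

  ∑-neg : {B : Set} (f : B → F) (xs : List B) → ∑ (λ x → - f x) xs ≡ - ∑ f xs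
  ∑-neg f [] = sym -0#≈0#
  ∑-neg f (x ∷ xs) = ≡-trans (cong (- f x +_) (∑-neg f xs)) (-‿+-comm _ _)

  -- The relations for `x ∷ Y` and for `y ∷ Y` share the term of the set containing both `x` and
  -- `y`. It cancels when they are subtracted.
  difference-vanish : ∀ {r G x y b} → Symmetric b → SumsVanish (suc r) (x ∷ y ∷ G) b →
    SumsVanish r G (λ V → b (x ∷ V) + - b (y ∷ V))
  difference-vanish {x = x} {y} {b} b-sym rel Y E p len = begin
    ∑ (λ a → b (x ∷ a ∷ Y) + - b (y ∷ a ∷ Y)) E
      ≡⟨ Σ.big-∙ _ _ E ⟩
    ∑ (λ a → b (x ∷ a ∷ Y)) E + ∑ (λ a → - b (y ∷ a ∷ Y)) E
      ≡⟨ cong₂ _+_ (exchange x) (≡-trans (∑-neg _ E) (cong -_ (exchange y))) ⟩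
    ∑ (λ a → b (a ∷ x ∷ Y)) E + - ∑ (λ a → b (a ∷ y ∷ Y)) E
      ≡⟨ cong (_+ - ∑ (λ a → b (a ∷ y ∷ Y)) E) (+-cancelˡ (b (y ∷ x ∷ Y)) _ _
           (≡-trans (rel (x ∷ Y) (y ∷ E) (prep x (↭-trans (shift y Y E) (prep y p))) (cong suc len))
           (≡-trans (sym (rel (y ∷ Y) (x ∷ E)
               (↭-trans (prep y (shift x Y E)) (↭-trans (swap y x refl) (prep x (prep y p)))) (cong suc len)))
             (cong (_+ ∑ (λ a → b (a ∷ y ∷ Y)) E) (b-sym (swap x y refl)))))) ⟩
    ∑ (λ a → b (a ∷ y ∷ Y)) E + - ∑ (λ a → b (a ∷ y ∷ Y)) E
      ≡⟨ -‿inverseʳ _ ⟩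
    0# ∎
    where
    exchange : ∀ z → ∑ (λ a → b (z ∷ a ∷ Y)) E ≡ ∑ (λ a → b (a ∷ z ∷ Y)) E
    exchange z = Σ.big-cong E (λ {a} _ → b-sym (swap z a refl))

  alternate-vanish : ∀ {r b} → Symmetric b → ∀ P {G} → SumsVanish (length P ℕ.+ r) (flatten P ++ G) b →
    SumsVanish r G (alternate b P)
  alternate-vanish b-sym [] rel = rel
  alternate-vanish {r} {b} b-sym ((x , y) ∷ P) {G} rel = difference-vanish (alternate-symmetric b-sym P)
    (alternate-vanish {suc r} b-sym P
        (λ Y E p len → rel Y E (↭-trans p moved) (≡-trans len (ℕₚ.+-suc (length P) r))))
    where
    moved : flatten P ++ x ∷ y ∷ G ↭ x ∷ y ∷ flatten P ++ G
    moved = ↭-trans (shift x (flatten P) (y ∷ G)) (prep x (shift y (flatten P) G))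

-- Elimination of the pairs.

module Elimination {q : ℕ} (𝔽 : FiniteField q) {k : ℕ} (𝔸 : ArcForm 𝔽 k (2 ℕ.+ q)) where

  open FieldProperties 𝔽
  open Multilinear 𝔽 using (dot; dot-zero)
  open Weights 𝔽 𝔸
  open InclusionSystem 𝔽 {I}
  open SemiringMult semiring using () renaming (_×_ to _·_)
  open ≡-Reasoning

  -- These are the lists at which `alternate f P V` evaluates `f`. Identities that rest on linear
  -- independence are then required at these lists only.
  data Choice : List (I × I) → List I → List I → Set where
    done : ∀ {V} → Choice [] V V
    left : ∀ {x y P V C} → Choice P (x ∷ V) C → Choice ((x , y) ∷ P) V C
    right : ∀ {x y P V C} → Choice P (y ∷ V) C → Choice ((x , y) ∷ P) V C

  choice-⊇ : ∀ {P V C} → Choice P V C → V ⊆ C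
  choice-⊇ done v∈ = v∈
  choice-⊇ (left ch) v∈ = choice-⊇ ch (there v∈)
  choice-⊇ (right ch) v∈ = choice-⊇ ch (there v∈)

  choice-length : ∀ {P V C} → Choice P V C → length C ≡ length P ℕ.+ length V
  choice-length done = refl
  choice-length (left {P = P} ch) = ≡-trans (choice-length ch) (ℕₚ.+-suc (length P) _)
  choice-length (right {P = P} ch) = ≡-trans (choice-length ch) (ℕₚ.+-suc (length P) _)

  choice-complement : ∀ {P V C} → Choice P V C → ∃[ D ] C ++ D ↭ V ++ flatten P
  choice-complement {V = V} done = [] , refl
  choice-complement {(x , y) ∷ P} {V} {C} (left ch) with D , p ← choice-complement ch =
    y ∷ D , ↭-trans (shift y C D) (↭-trans (prep y p) (↭-trans (swap y x refl)
      (↭-sym (↭-trans (shift x V (y ∷ flatten P)) (prep x (shift y V (flatten P)))))))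
  choice-complement {(x , y) ∷ P} {V} {C} (right ch) with D , p ← choice-complement ch =
    x ∷ D , ↭-trans (shift x C D) (↭-trans (prep x p)
      (↭-sym (↭-trans (shift x V (y ∷ flatten P)) (prep x (shift y V (flatten P))))))

  alternate-cong : ∀ {f g} P V → (∀ {C} → Choice P V C → f C ≡ g C) → alternate f P V ≡ alternate g P V
  alternate-cong [] V eq = eq done
  alternate-cong ((x , y) ∷ P) V eq = cong₂ (λ u v → u + - v)
    (alternate-cong P (x ∷ V) (eq ∘ left)) (alternate-cong P (y ∷ V) (eq ∘ right))

  alternate-zero : ∀ {f} P V → (∀ {C} → Choice P V C → f C ≡ 0#) → alternate f P V ≡ 0#
  alternate-zero [] V eq = eq done
  alternate-zero ((x , y) ∷ P) V eq = ≡-trans (cong₂ (λ u v → u + - v)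
    (alternate-zero P (x ∷ V) (eq ∘ left)) (alternate-zero P (y ∷ V) (eq ∘ right))) (-‿inverseʳ 0#)

  alternate-linear : ∀ c f g P V → alternate (λ C → c * f C + g C) P V ≡ c * alternate f P V + alternate g P V
  alternate-linear c f g [] V = refl
  alternate-linear c f g ((x , y) ∷ P) V = begin
    alternate (λ C → c * f C + g C) P (x ∷ V) + - alternate (λ C → c * f C + g C) P (y ∷ V)
      ≡⟨ cong₂ (λ u v → u + - v) (alternate-linear c f g P (x ∷ V)) (alternate-linear c f g P (y ∷ V)) ⟩
    (c * fx + gx) + - (c * fy + gy)
      ≡⟨ cong (c * fx + gx +_) (≡-trans (sym (-‿+-comm (c * fy) gy)) (cong (_+ - gy) (-‿distribʳ-* c fy))) ⟩
    (c * fx + gx) + (c * - fy + - gy)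
      ≡⟨ Σ.interchange _ _ _ _ ⟩
    (c * fx + c * - fy) + (gx + - gy)
      ≡⟨ cong (_+ (gx + - gy)) (sym (distribˡ c fx (- fy))) ⟩
    c * (fx + - fy) + (gx + - gy) ∎
    where
    fx fy gx gy : F
    fx = alternate f P (x ∷ V)
    fy = alternate f P (y ∷ V)
    gx = alternate g P (x ∷ V)
    gy = alternate g P (y ∷ V)

  -- Coefficients with respect to a fixed basis do not depend on the hyperplane, so the expansion
  -- can be taken out of the alternating sum.
  alternate-dot : ∀ (u : List I → F) (g : I → List I → F) P V cs Z →
    alternate (λ C → u C * dot cs Z (λ z → g z C)) P V ≡ dot cs Z (λ z → alternate (λ C → u C * g z C) P V)
  alternate-dot u g P V [] Z = alternate-zero P V (λ _ → zeroʳ _)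
  alternate-dot u g P V (c ∷ cs) [] = alternate-zero P V (λ _ → zeroʳ _)
  alternate-dot u g P V (c ∷ cs) (z ∷ Z) = begin
    alternate (λ C → u C * (c * g z C + dot cs Z (λ z → g z C))) P V
      ≡⟨ alternate-cong P V (λ {C} _ → solve 4 (λ u c g t → u :* (c :* g :+ t) := c :* (u :* g) :+ u :* t) refl
           (u C) c (g z C) (dot cs Z (λ z → g z C))) ⟩
    alternate (λ C → c * (u C * g z C) + u C * dot cs Z (λ z → g z C)) P V
      ≡⟨ alternate-linear c _ _ P V ⟩
    c * alternate (λ C → u C * g z C) P V + alternate (λ C → u C * dot cs Z (λ z → g z C)) P V
      ≡⟨ cong (c * alternate (λ C → u C * g z C) P V +_) (alternate-dot u g P V cs Z) ⟩
    c * alternate (λ C → u C * g z C) P V + dot cs Z (λ z → alternate (λ C → u C * g z C) P V) ∎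

  dot-drop : ∀ cs V Z (f : I → F) → (∀ {v} → v ∈ V → f v ≡ 0#) → dot cs (V ++ Z) f
      ≡ dot (drop (length V) cs) Z f
  dot-drop cs [] Z f f≡0 = refl
  dot-drop [] (v ∷ V) Z f f≡0 = refl
  dot-drop (c ∷ cs) (v ∷ V) Z f f≡0 = ≡-trans
    (cong₂ _+_ (≡-trans (cong (c *_) (f≡0 (here refl))) (zeroʳ c)) (dot-drop cs V Z f (f≡0 ∘ there)))
    (+-identityˡ _)

  -- Expanding x in the basis V ++ Z with |Z| = |P| + 1, the corresponding combination of the relations for the sets
  -- Z \ z kills every term whose hyperplane contains x.  What remains is a relation with one pair fewer.
  eliminate : ∀ P V W (v : List I → F) → (∀ C → v C ≢ 0#) → Distinct (V ++ flatten P ++ W) →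
    suc (length P ℕ.+ length V) ≡ k → length W ≡ length P ℕ.+ length P →
    (∀ Z Z′ → Z ++ Z′ ↭ W → length Z ≡ length P → alternate (λ C → v C * weight Z C) P V ≡ 0#) → ⊥
  eliminate [] V W v v≢0 u lenV lenW rel = *-nonZero (v≢0 V) 1≢0 (rel [] W refl refl)
  eliminate ((x , y) ∷ P) V [] v v≢0 u lenV () rel
  eliminate ((x , y) ∷ P) V (w ∷ []) v v≢0 u lenV lenW rel =
    contradiction (≡-trans (ℕₚ.suc-injective lenW) (ℕₚ.+-suc (length P) _)) λ ()
  eliminate P′@((x , y) ∷ P) V W′@(w₁ ∷ w₂ ∷ W) v v≢0 u lenV lenW rel =
    eliminate P (y ∷ V) W v′ v′≢0 u′ (≡-trans (cong suc (ℕₚ.+-suc (length P) _)) lenV)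
      (ℕₚ.suc-injective (≡-trans (ℕₚ.suc-injective lenW) (ℕₚ.+-suc (length P) _))) rel′
    where
    -- The new relations vary `Z` alone, so `w₁` and `w₂` join the fixed factor. The double `θ`
    -- stands for `d (x ∷ C)`, with which it agrees wherever that is nonzero, and it keeps `v′`
    -- nonzero at every list.
    v′ : List I → F
    v′ C = v C * weight (w₁ ∷ w₂ ∷ []) C * θ (θ (d (x ∷ C)))
    v′≢0 : ∀ C → v′ C ≢ 0#
    v′≢0 C = *-nonZero (*-nonZero (v≢0 C) (weight≢0 (w₁ ∷ w₂ ∷ []) C)) (θ≢0 (θ (d (x ∷ C))))
    move-W : V ++ flatten P′ ++ W′ ↭ w₁ ∷ w₂ ∷ (V ++ flatten P′ ++ W)
    move-W = ↭-trans (++⁺ˡ V (↭-trans (shift w₁ (flatten P′) (w₂ ∷ W)) (prep w₁ (shift w₂ (flatten P′) W))))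
      (↭-trans (shift w₁ V _) (prep w₁ (shift w₂ V _)))
    u₁ : Distinct (x ∷ y ∷ V ++ flatten P ++ W)
    u₁ = unique-↭ (↭-trans (shift x V _) (prep x (shift y V _))) (unique-tail (unique-tail (unique-↭ move-W u)))
    u′ : Distinct ((y ∷ V) ++ flatten P ++ W)
    u′ = unique-tail u₁
    uVW : Distinct (V ++ W′)
    uVW = unique-++ʳ (flatten P′) (unique-↭ (shifts V (flatten P′)) u)
    choice-unique : ∀ {C Q P₀ V₀} → Distinct (V₀ ++ flatten P₀ ++ Q) → Choice P₀ V₀ C → Distinct (C ++ Q)
    choice-unique {C} {Q} {P₀} {V₀} un ch with D , p ← choice-complement ch =
      unique-++ʳ D (subst Distinct (++-assoc D C Q)
        (unique-↭ (++⁺ʳ Q (↭-trans (↭-sym p) (++-comm C D)))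
            (subst Distinct (sym (++-assoc V₀ (flatten P₀) Q)) un)))
    rel′ : ∀ Z Z′ → Z ++ Z′ ↭ W → length Z ≡ length P → alternate (λ C → v′ C * weight Z C) P (y ∷ V) ≡ 0#
    rel′ Z Z′ p lenZ = begin
      alternate (λ C → v′ C * weight Z C) P (y ∷ V)
        ≡⟨ alternate-cong P (y ∷ V) regroup ⟩
      alternate (λ C → v C * weight Z⁺ C * d (x ∷ C)) P (y ∷ V)
        ≡⟨ sym (-‿involutive _) ⟩
      - - alternate (λ C → v C * weight Z⁺ C * d (x ∷ C)) P (y ∷ V)
        ≡⟨ cong -_ (begin
          - alternate (λ C → v C * weight Z⁺ C * d (x ∷ C)) P (y ∷ V)
            ≡⟨ sym (+-identityˡ _) ⟩
          0# + - alternate (λ C → v C * weight Z⁺ C * d (x ∷ C)) P (y ∷ V)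
            ≡⟨ cong (_+ - alternate (λ C → v C * weight Z⁺ C * d (x ∷ C)) P (y ∷ V))
                (sym (alternate-zero P (x ∷ V) x-term)) ⟩
          alternate (λ C → v C * weight Z⁺ C * d (x ∷ C)) P′ V
            ≡⟨ alternate-cong P′ V (λ ch → cong (v _ * weight Z⁺ _ *_) (expand ch)) ⟩
          alternate (λ C → v C * weight Z⁺ C * dot cs′ Z⁺ (λ z → d (z ∷ C))) P′ V
            ≡⟨ alternate-dot (λ C → v C * weight Z⁺ C) (λ z C → d (z ∷ C)) P′ V cs′ Z⁺ ⟩
          dot cs′ Z⁺ (λ z → alternate (λ C → v C * weight Z⁺ C * d (z ∷ C)) P′ V)
            ≡⟨ dot-zero cs′ Z⁺ z-term ⟩
          0# ∎) ⟩
      - 0#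
        ≡⟨ -0#≈0# ⟩
      0# ∎
      where
      -- One element more than there are pairs in `P′`: `V ++ Z⁺` is then a basis, and deleting any
      -- `z` from `Z⁺` leaves a set to which `rel` applies.
      Z⁺ : List I
      Z⁺ = w₁ ∷ w₂ ∷ Z
      p⁺ : Z⁺ ++ Z′ ↭ W′
      p⁺ = prep w₁ (prep w₂ p)
      basis-unique : Distinct (V ++ Z⁺)
      basis-unique = unique-++ˡ (V ++ Z⁺)
          (subst Distinct (sym (++-assoc V Z⁺ Z′)) (unique-↭ (++⁺ˡ V (↭-sym p⁺)) uVW))
      basis-length : length (V ++ Z⁺) ≡ k
      basis-length = begin
        length (V ++ Z⁺)                     ≡⟨ length-++ V ⟩
        length V ℕ.+ (2 ℕ.+ length Z)        ≡⟨ cong (λ n → length V ℕ.+ (2 ℕ.+ n)) lenZ ⟩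
        length V ℕ.+ (2 ℕ.+ length P)        ≡⟨ ℕₚ.+-comm (length V) _ ⟩
        2 ℕ.+ length P ℕ.+ length V          ≡⟨ lenV ⟩
        k                                    ∎
      cs cs′ : List F
      cs = proj₁ (expansion basis-unique basis-length x)
      cs′ = drop (length V) cs
      expand : ∀ {C} → Choice P′ V C → d (x ∷ C) ≡ dot cs′ Z⁺ (λ z → d (z ∷ C))
      expand {C} ch = ≡-trans (proj₂ (expansion basis-unique basis-length x) C)
        (dot-drop cs V Z⁺ (λ z → d (z ∷ C)) (λ v∈V → repeated (choice-⊇ ch v∈V)))
      x-term : ∀ {C} → Choice P (x ∷ V) C → v C * weight Z⁺ C * d (x ∷ C) ≡ 0#
      x-term {C} ch = ≡-trans (cong (v C * weight Z⁺ C *_) (repeated (choice-⊇ ch (here refl)))) (zeroʳ _)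
      z-term : ∀ {z} → z ∈ Z⁺ → alternate (λ C → v C * weight Z⁺ C * d (z ∷ C)) P′ V ≡ 0#
      z-term {z} z∈ with M , r ← ∈-split z∈ = ≡-trans (alternate-cong P′ V cancel)
        (rel M (z ∷ Z′) (↭-trans (shift z M Z′) (↭-trans (++⁺ʳ Z′ (↭-sym r)) p⁺))
          (≡-trans (ℕₚ.suc-injective (sym (↭-length r))) (cong suc lenZ)))
        where
        cancel : ∀ {C} → Choice P′ V C → v C * weight Z⁺ C * d (z ∷ C) ≡ v C * weight M C
        cancel {C} ch = begin
          v C * weight Z⁺ C * d (z ∷ C)
            ≡⟨ cong (λ e → v C * e * d (z ∷ C)) (weight-↭ r) ⟩
          v C * (θ (d (z ∷ C)) * weight M C) * d (z ∷ C)
            ≡⟨ solve 4 (λ v t m d → v :* (t :* m) :* d := v :* m :* (t :* d)) refl (v C) (θ (d (z ∷ C)))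
                (weight M C) (d (z ∷ C)) ⟩
          v C * weight M C * (θ (d (z ∷ C)) * d (z ∷ C))
            ≡⟨ cong (v C * weight M C *_)
                (θ-inverseˡ (independent (unique-∷ z∉C (unique-++ˡ C uCW))
                (≡-trans (cong suc (choice-length ch)) lenV))) ⟩
          v C * weight M C * 1#
            ≡⟨ *-identityʳ _ ⟩
          v C * weight M C ∎
          where
          uCW : Distinct (C ++ W′)
          uCW = choice-unique u ch
          z∉C : z ∉ C
          z∉C z∈C = disjoint C uCW z∈C (∈-resp-↭ p⁺ (∈-++⁺ˡ z∈))
      regroup : ∀ {C} → Choice P (y ∷ V) C → v′ C * weight Z C ≡ v C * weight Z⁺ C * d (x ∷ C)
      regroup {C} ch = begin
        v C * weight (w₁ ∷ w₂ ∷ []) C * θ (θ (d (x ∷ C))) * weight Z C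
          ≡⟨ cong (λ e → v C * weight (w₁ ∷ w₂ ∷ []) C * e * weight Z C) (θθ (independent uxC len)) ⟩
        v C * weight (w₁ ∷ w₂ ∷ []) C * d (x ∷ C) * weight Z C
          ≡⟨ solve 4 (λ a b c e → a :* b :* c :* e := a :* (b :* e) :* c) refl (v C) (weight (w₁ ∷ w₂ ∷ []) C)
              (d (x ∷ C)) (weight Z C) ⟩
        v C * (weight (w₁ ∷ w₂ ∷ []) C * weight Z C) * d (x ∷ C)
          ≡⟨ cong (λ e → v C * e * d (x ∷ C)) (sym (weight-++ (w₁ ∷ w₂ ∷ []) Z C)) ⟩
        v C * weight Z⁺ C * d (x ∷ C) ∎
        where
        len : suc (length C) ≡ k
        len = ≡-trans (cong suc (≡-trans (choice-length ch) (ℕₚ.+-suc (length P) _))) lenV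
        uxC : Distinct (x ∷ C)
        uxC with D , r ← choice-complement ch = unique-++ˡ (x ∷ C) (unique-↭ (prep x (↭-sym r))
          (unique-++ˡ (x ∷ (y ∷ V) ++ flatten P)
              (subst Distinct (cong (x ∷_) (sym (++-assoc (y ∷ V) (flatten P) W))) u₁)))

  -- The relations for a configuration of pairs P, an r-set V, padding H and a reservoir W.

  module _ (P : List (I × I)) (V W H : List I)
           (u : Distinct (flatten P ++ V ++ H ++ W))
           (length-W : length W ≡ length P ℕ.+ length P)
           (length-H : suc (length H ℕ.+ length P) ≡ length V)
           (length-PV : suc (length P ℕ.+ length V) ≡ k)
           (invertible : ∀ {j} → 0 ℕ.< j → j ℕ.≤ length V → j · 1# ≢ 0#)
           (bound : k ℕ.+ k ℕ.≤ 4 ℕ.+ q) where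

    length-flatten : ∀ P → length (flatten P) ≡ length P ℕ.+ length P
    length-flatten [] = refl
    length-flatten ((x , y) ∷ P) =
        cong suc (≡-trans (cong suc (length-flatten P)) (sym (ℕₚ.+-suc (length P) _)))

    -- Every `Z` drawn from `W` has its own ground set `G` and its own system. As `P`, `V` and `H`
    -- are common to all of them, the relations obtained differ only in the factor `weight Z C`.
    module _ (Z Z′ : List I) (p : Z ++ Z′ ↭ W) (length-Z : length Z ≡ length P) where

      G : List I
      G = flatten P ++ V ++ H ++ Z

      uG : Distinct G
      uG = unique-++ˡ G (unique-↭ (↭-sym split) u)
        where
        split : G ++ Z′ ↭ flatten P ++ V ++ H ++ W
        split = subst (_↭ flatten P ++ V ++ H ++ W) (sym (begin
          (flatten P ++ V ++ H ++ Z) ++ Z′    ≡⟨ ++-assoc (flatten P) _ Z′ ⟩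
          flatten P ++ (V ++ H ++ Z) ++ Z′    ≡⟨ cong (flatten P ++_) (++-assoc V _ Z′) ⟩
          flatten P ++ V ++ (H ++ Z) ++ Z′    ≡⟨ cong (λ L → flatten P ++ V ++ L) (++-assoc H Z Z′) ⟩
          flatten P ++ V ++ H ++ Z ++ Z′      ∎)) (++⁺ˡ (flatten P) (++⁺ˡ V (++⁺ˡ H p)))

      length-HZ : suc (length (H ++ Z)) ≡ length V
      length-HZ = ≡-trans (cong suc (≡-trans (length-++ H) (cong (length H ℕ.+_) length-Z))) length-H

      length-G : length G ℕ.+ 3 ≡ k ℕ.+ k
      length-G = begin
        length G ℕ.+ 3
          ≡⟨ cong (ℕ._+ 3) (≡-trans (length-++ (flatten P)) (cong₂ ℕ._+_ (length-flatten P) (length-++ V))) ⟩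
        length P ℕ.+ length P ℕ.+ (length V ℕ.+ length (H ++ Z)) ℕ.+ 3
          ≡⟨ arith (length P) (length V) (length (H ++ Z)) ⟩
        suc (length P ℕ.+ length V) ℕ.+ suc (length P ℕ.+ suc (length (H ++ Z)))
          ≡⟨ cong (λ n → suc (length P ℕ.+ length V) ℕ.+ suc (length P ℕ.+ n)) length-HZ ⟩
        suc (length P ℕ.+ length V) ℕ.+ suc (length P ℕ.+ length V)
          ≡⟨ cong (λ n → n ℕ.+ n) length-PV ⟩
        k ℕ.+ k ∎
        where
        arith : ∀ p v h → p ℕ.+ p ℕ.+ (v ℕ.+ h) ℕ.+ 3 ≡ suc (p ℕ.+ v) ℕ.+ suc (p ℕ.+ suc h)
        arith = solve-∀

      Good : List I → Set
      Good C = Distinct C × C ⊆ G × suc (length C) ≡ k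

      good? : ∀ C → Dec (Good C)
      good? C = unique? _≟_ C ×-dec
          (map′ (λ a {x} → All.lookup a {x}) (λ s → All.tabulate s) (All.all? (λ x → _∈?_ _≟_ x G) C) ×-dec
          (suc (length C) ℕₚ.≟ k))

      good-↭ : ∀ {C C′} → C ↭ C′ → Good C → Good C′
      good-↭ r (uC , C⊆G , lenC) =
        unique-↭ r uC , (λ {x} x∈ → C⊆G (∈-resp-↭ (↭-sym r) x∈)) , ≡-trans (cong suc (sym (↭-length r))) lenC

      -- The weight is known to be independent of order only for k - 1 distinct members of `G`. The
      -- value zero elsewhere yields a function that is symmetric on all lists, as `Symmetric`
      -- demands.
      b : List I → F
      b C with good? C
      ... | yes _ = weight (points ++ G) C
      ... | no _ = 0#

      b-good : ∀ {C} → Good C → b C ≡ weight (points ++ G) C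
      b-good {C} good with good? C
      ... | yes _ = refl
      ... | no ¬good = contradiction good ¬good

      b-symmetric : Symmetric b
      b-symmetric {C} {C′} r with good? C | good? C′
      ... | yes (uC , C⊆G , lenC) | yes _ = weight-symmetric r uC C⊆G uG lenC length-G
      ... | yes good | no ¬good′ = contradiction (good-↭ r good) ¬good′
      ... | no ¬good | yes good′ = contradiction (good-↭ (↭-sym r) good′) ¬good
      ... | no _ | no _ = refl

      b-sumsVanish : SumsVanish (length P ℕ.+ length V) G b
      b-sumsVanish Y E r lenY = begin
        ∑ (λ a → b (a ∷ Y)) E
          ≡⟨ Σ.big-cong E (λ {a} a∈E → ≡-trans (b-good (good a∈E)) (weight-↭ (++⁺ˡ points (↭-sym r)))) ⟩
        ∑ (λ a → weight (points ++ Y ++ E) (a ∷ Y)) E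
          ≡⟨ interpolation {Y} {E} uYE lenY′ lenE bound ⟩
        0# ∎
        where
        uYE : Distinct (Y ++ E)
        uYE = unique-↭ (↭-sym r) uG
        lenY′ : 2 ℕ.+ length Y ≡ k
        lenY′ = ≡-trans (cong suc lenY) length-PV
        lenE : suc (length E) ≡ k
        lenE = ℕₚ.+-cancelˡ-≡ k _ _ (begin
          k ℕ.+ suc (length E)                     ≡⟨ cong (ℕ._+ suc (length E)) (sym lenY′) ⟩
          2 ℕ.+ length Y ℕ.+ suc (length E)        ≡⟨ arith (length Y) (length E) ⟩
          (length Y ℕ.+ length E) ℕ.+ 3            ≡⟨ cong (ℕ._+ 3) (sym (length-++ Y)) ⟩
          length (Y ++ E) ℕ.+ 3                    ≡⟨ cong (ℕ._+ 3) (↭-length r) ⟩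
          length G ℕ.+ 3                           ≡⟨ length-G ⟩
          k ℕ.+ k                                  ∎)
          where
          arith : ∀ y e → 2 ℕ.+ y ℕ.+ suc e ≡ (y ℕ.+ e) ℕ.+ 3
          arith = solve-∀
        good : ∀ {a} → a ∈ E → Good (a ∷ Y)
        good a∈E = unique-∷ (λ a∈Y → disjoint Y uYE a∈Y a∈E) (unique-++ˡ Y uYE)
          , (λ { (here refl) → ∈-resp-↭ r (∈-++⁺ʳ Y a∈E) ; (there y∈Y) → ∈-resp-↭ r (∈-++⁺ˡ y∈Y) })
          , lenY′

      alternate-b : alternate b P V ≡ 0#
      alternate-b = inversion invertible
        (alternate-vanish b-symmetric P b-sumsVanish) V (H ++ Z) refl refl length-HZ
        where open Inversion (alternate-symmetric b-symmetric P)

      relation : alternate (λ C → weight (points ++ flatten P ++ V ++ H) C * weight Z C) P V ≡ 0#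
      relation = ≡-trans (alternate-cong P V (λ {C} ch → sym (≡-trans (b-good (good ch)) (≡-trans
          (cong (λ Q → weight Q C) (sym assoc)) (weight-++ (points ++ flatten P ++ V ++ H) Z C))))) alternate-b
        where
        assoc : (points ++ flatten P ++ V ++ H) ++ Z ≡ points ++ G
        assoc = begin
          (points ++ flatten P ++ V ++ H) ++ Z    ≡⟨ ++-assoc points _ Z ⟩
          points ++ (flatten P ++ V ++ H) ++ Z    ≡⟨ cong (points ++_) (++-assoc (flatten P) _ Z) ⟩
          points ++ flatten P ++ (V ++ H) ++ Z    ≡⟨ cong (λ L → points ++ flatten P ++ L) (++-assoc V H Z) ⟩
          points ++ G                             ∎
        good : ∀ {C} → Choice P V C → Good C
        good {C} ch with D , r ← choice-complement ch =
          unique-++ˡ C (unique-↭ (↭-sym r′) (unique-++ˡ (flatten P ++ V) uG′)) , C⊆G , ≡-trans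
              (cong suc (choice-length ch)) length-PV
          where
          r′ : C ++ D ↭ flatten P ++ V
          r′ = ↭-trans r (++-comm V (flatten P))
          uG′ : Distinct ((flatten P ++ V) ++ H ++ Z)
          uG′ = subst Distinct (sym (++-assoc (flatten P) V (H ++ Z))) uG
          C⊆G : C ⊆ G
          C⊆G x∈C = subst (_ ∈_) (++-assoc (flatten P) V (H ++ Z)) (∈-++⁺ˡ (∈-resp-↭ r′ (∈-++⁺ˡ x∈C)))

    absurdity : ⊥
    absurdity = eliminate P V W (weight (points ++ flatten P ++ V ++ H))
        (weight≢0 (points ++ flatten P ++ V ++ H)) u′ length-PV length-W relation
      where
      u′ : Distinct (V ++ flatten P ++ W)
      u′ = unique-++ʳ H (unique-↭ r u)
        where
        r : flatten P ++ V ++ H ++ W ↭ H ++ V ++ flatten P ++ W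
        r = ↭-trans (++⁺ˡ (flatten P) (shifts V H))
            (↭-trans (shifts (flatten P) H) (++⁺ˡ H (shifts (flatten P) V)))

lookup-injective : ∀ {a ℓ} (A : Setoid a ℓ) {xs : List (Setoid.Carrier A)} → UniqueSetoid.Unique A xs →
  ∀ {i j} → Setoid._≈_ A (lookup xs i) (lookup xs j) → i ≡ j
lookup-injective A (x∉ ∷ u) {zero} {zero} eq = refl
lookup-injective A {x ∷ xs} (x∉ ∷ u) {zero} {suc j} eq =
  contradiction (SetoidMembershipₚ.∈-resp-≈ A (Setoid.sym A eq) (SetoidMembershipₚ.∈-lookup A xs j))
    (UniqueSetoidₚ.Unique[x∷xs]⇒x∉xs A (x∉ ∷ u))
lookup-injective A {x ∷ xs} (x∉ ∷ u) {suc i} {zero} eq =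
  contradiction (SetoidMembershipₚ.∈-resp-≈ A eq (SetoidMembershipₚ.∈-lookup A xs i))
    (UniqueSetoidₚ.Unique[x∷xs]⇒x∉xs A (x∉ ∷ u))
lookup-injective A (x∉ ∷ u) {suc i} {suc j} eq = cong suc (lookup-injective A u eq)

-- Passage from the given field and set of vectors to `Fin q`.

module Transport {c ℓ₁ ℓ₂} (H : HeytingField c ℓ₁ ℓ₂) {q : ℕ}
    (card : HasCardinality (HeytingField.setoid H) q) where

  private
    module H = HeytingField H
    module B = Inverse card
  open H using (Carrier; _≈_)

  to : Carrier → Fin q
  to = B.to

  from : Fin q → Carrier
  from = B.from

  to-from : ∀ x → to (from x) ≡ x
  to-from x = B.strictlyInverseˡ x

  from-to : ∀ x → from (to x) ≈ x
  from-to x = B.strictlyInverseʳ x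

  rawRing : RawRing _ _
  rawRing = record
    { Carrier = Fin q
    ; _≈_ = _≡_
    ; _+_ = λ x y → to (from x H.+ from y)
    ; _*_ = λ x y → to (from x H.* from y)
    ; -_ = λ x → to (H.- from x)
    ; 0# = to H.0#
    ; 1# = to H.1#
    }

  from-isMonomorphism : IsRingMonomorphism rawRing (record
    { Carrier = Carrier ; _≈_ = H._≈_ ; _+_ = H._+_ ; _*_ = H._*_ ; -_ = H.-_ ; 0# = H.0# ; 1# = H.1# }) from
  from-isMonomorphism = record
    { isRingHomomorphism = record
      { isSemiringHomomorphism = record
        { isNearSemiringHomomorphism = record
          { +-isMonoidHomomorphism = record
            { isMagmaHomomorphism = record
              { isRelHomomorphism = record { cong = B.from-cong }
              ; homo = λ _ _ → from-to _
              }
            ; ε-homo = from-to _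
            }
          ; *-homo = λ _ _ → from-to _
          }
        ; 1#-homo = from-to _
        }
      ; -‿homo = λ _ → from-to _
      }
    ; injective = λ {x} {y} eq → ≡-trans (sym (to-from x)) (≡-trans (B.to-cong eq) (to-from y))
    }

  x-0≈x : ∀ x → x H.- H.0# ≈ x
  x-0≈x x = H.trans (H.+-congˡ (H.trans (H.sym (H.+-identityˡ _)) (H.-‿inverseʳ H.0#))) (H.+-identityʳ x)

  1≉0 : ¬ (H.1# ≈ H.0#)
  1≉0 eq = proj₂ (H.tight H.1# H.0#) eq (H.invertible⇒# (H.1# , 1*[1-0] , H.trans (H.*-comm _ _) 1*[1-0]))
    where
    1*[1-0] : H.1# H.* (H.1# H.- H.0#) ≈ H.1#
    1*[1-0] = H.trans (H.*-identityˡ _) (x-0≈x H.1#)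

  finiteField : FiniteField q
  finiteField = record
    { RawRing rawRing
    ; isCommutativeRing = RingMonomorphism.isCommutativeRing from-isMonomorphism H.isCommutativeRing
    ; 1≢0 = λ eq → 1≉0 (H.trans (H.sym (from-to _)) (H.trans (B.from-cong eq) (from-to _)))
    ; inverse = inverse
    }
    where
    inverse : ∀ {x} → x ≢ to H.0# → ∃[ y ] to (from x H.* from y) ≡ to H.1#
    -- Inverses are found by search, which is finite. If the search fails, `x` is not apart from
    -- zero, and tightness makes it equal to zero.
    inverse {x} x≢0 with any? (λ y → to (from x H.* from y) ≟ to H.1#)
    ... | yes found = found
    ... | no none = contradiction (≡-trans (sym (to-from x)) (B.to-cong (proj₁ (H.tight (from x) H.0#) ¬#))) x≢0
      where
      ¬# : ¬ (from x H.# H.0#)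
      ¬# x#0 with z , _ , eq ← H.#⇒invertible x#0 = none (to z , B.to-cong
        (H.trans (H.*-cong (H.sym (x-0≈x (from x))) (from-to z)) eq))

  open FiniteField finiteField using (_+_; _*_)

  to-+ : ∀ x y → to (x H.+ y) ≡ to x + to y
  to-+ x y = B.to-cong (H.+-cong (H.sym (from-to x)) (H.sym (from-to y)))

  to-* : ∀ x y → to (x H.* y) ≡ to x * to y
  to-* x y = B.to-cong (H.*-cong (H.sym (from-to x)) (H.sym (from-to y)))

  open VectorSpace H using (IsBasis; EverySubsetOfSizeIsBasis; Unique) renaming
      (linearCombination to linearCombinationᴴ; _⊆_ to _⊆ᴴ_)
  open Multilinear finiteField

  module _ {k : ℕ} where

    open VectorEquality H.setoid using (_≋_; ≋-setoid)

    coordinatesᵛ : Vector Carrier k → Vec (Fin q) k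
    coordinatesᵛ v = Vec.tabulate (λ j → to (v j))

    lookup-⊕ : ∀ {k} (u v : Vec (Fin q) k) j → Vec.lookup (u ⊕ v) j ≡ Vec.lookup u j + Vec.lookup v j
    lookup-⊕ (a ∷ u) (b ∷ v) zero = refl
    lookup-⊕ (a ∷ u) (b ∷ v) (suc j) = lookup-⊕ u v j

    lookup-⊙ : ∀ {k} c (v : Vec (Fin q) k) j → Vec.lookup (c ⊙ v) j ≡ c * Vec.lookup v j
    lookup-⊙ c (a ∷ v) zero = refl
    lookup-⊙ c (a ∷ v) (suc j) = lookup-⊙ c v j

    lookup-zeros : ∀ {k} (j : Fin k) → Vec.lookup (zeros k) j ≡ to H.0#
    lookup-zeros zero = refl
    lookup-zeros (suc j) = lookup-zeros j

    lookup-linearCombination : ∀ (vs : List (Vector Carrier k)) (a : Vector Carrier (length vs)) j →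
      Vec.lookup (linearCombination (tabulate (to ∘ a)) (map coordinatesᵛ vs)) j
          ≡ to (linearCombinationᴴ a (lookup vs) j)
    lookup-linearCombination [] a j = lookup-zeros j
    lookup-linearCombination (v ∷ vs) a j = begin
      Vec.lookup (to (a zero) ⊙ coordinatesᵛ v ⊕ linearCombination (tabulate (to ∘ a ∘ suc))
          (map coordinatesᵛ vs)) j
        ≡⟨ lookup-⊕ (to (a zero) ⊙ coordinatesᵛ v) _ j ⟩
      Vec.lookup (to (a zero) ⊙ coordinatesᵛ v) j
          + Vec.lookup (linearCombination (tabulate (to ∘ a ∘ suc)) (map coordinatesᵛ vs)) j
        ≡⟨ cong₂ _+_ (≡-trans (lookup-⊙ (to (a zero)) (coordinatesᵛ v) j)
            (cong (to (a zero) *_) (Vecₚ.lookup∘tabulate _ j)))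
                     (lookup-linearCombination vs (a ∘ suc) j) ⟩
      to (a zero) * to (v j) + to (linearCombinationᴴ (a ∘ suc) (lookup vs) j)
        ≡⟨ cong (_+ to (linearCombinationᴴ (a ∘ suc) (lookup vs) j)) (sym (to-* (a zero) (v j))) ⟩
      to (a zero H.* v j) + to (linearCombinationᴴ (a ∘ suc) (lookup vs) j)
        ≡⟨ sym (to-+ _ _) ⟩
      to (linearCombinationᴴ a (lookup (v ∷ vs)) j) ∎
      where open ≡-Reasoning

    spans : ∀ (vs : List (Vector Carrier k)) → IsBasis (lookup vs) →
      ∀ w → ∃[ cs ] w ≡ linearCombination cs (map coordinatesᵛ vs)
    spans vs (_ , spanning) w with a , eq ← spanning (from ∘ Vec.lookup w) =
      tabulate (to ∘ a) , lookup-ext _ _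
          (λ j → sym (≡-trans (lookup-linearCombination vs a j) (≡-trans (B.to-cong (eq j)) (to-from _))))
      where
      lookup-ext : ∀ {k} (u v : Vec (Fin q) k) → (∀ j → Vec.lookup u j ≡ Vec.lookup v j) → u ≡ v
      lookup-ext [] [] eq = refl
      lookup-ext (a ∷ u) (b ∷ v) eq = cong₂ _∷_ (eq zero) (lookup-ext u v (eq ∘ suc))

    module _ {S : List (Vector Carrier k)} (u : Unique S) (bases : EverySubsetOfSizeIsBasis k S) {N : ℕ}
        (N≤|S| : N ℕ.≤ length S) where

      -- Only the first `N` members of `S` are kept, so a set larger than q + 2 is covered as well.
      vector : Fin N → Vector Carrier k
      vector i = lookup S (inject≤ i N≤|S|)

      vector-injective : ∀ {i j} → vector i ≋ vector j → i ≡ j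
      vector-injective {i} {j} eq = inject≤-injective N≤|S| N≤|S| i j (lookup-injective (≋-setoid k) u eq)

      vectors-⊆ : ∀ is → map vector is ⊆ᴴ S
      vectors-⊆ (i ∷ is) (here eq) = SetoidMembershipₚ.∈-resp-≈ (≋-setoid k) (Setoid.sym (≋-setoid k) eq)
        (SetoidMembershipₚ.∈-lookup (≋-setoid k) S (inject≤ i N≤|S|))
      vectors-⊆ (i ∷ is) (there x∈) = vectors-⊆ is x∈

      row : Fin N → Vec (Fin q) k
      row i = coordinatesᵛ (vector i)

      rows-span : ∀ {is} → Distinct is → length is ≡ k →
        ∀ w → ∃[ cs ] w ≡ linearCombination cs (map row is)
      rows-span {is} uis len w = subst (λ L → ∃[ cs ] w ≡ linearCombination cs L) (map-∘-row is)
        (spans (map vector is) (bases (map vector is)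
          (UniqueSetoidₚ.map⁺ (≡.setoid (Fin N)) (≋-setoid k) vector-injective uis) (vectors-⊆ is)
              (≡-trans (length-map vector is) len)) w)
        where
        map-∘-row : ∀ is → map coordinatesᵛ (map vector is) ≡ map row is
        map-∘-row [] = refl
        map-∘-row (i ∷ is) = cong (row i ∷_) (map-∘-row is)

      arcForm : ArcForm finiteField k N
      arcForm = record
        { d = λ is → det k (map row is)
        ; signed = λ p → let σ , σσ , eq = signed (map⁺ row p) in σ , σσ , λ L →
            subst₂ (λ A B → det k A ≡ σ * det k B) (sym (map-++ row L _)) (sym (map-++ row L _))
                (eq (map row L))
        ; antisymmetric = λ x y R → det-antisymmetric k [] (row x) (row y) (map row R)
        ; repeated = λ x∈ → repeated (∈-map⁺ row x∈)
        ; independent = λ {is} uis len →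
            det≢0 (map row is) (≡-trans (length-map row is) len) (rows-span uis len)
        ; expansion = λ {B} uB len x → let cs , eq = rows-span uB len (row x) in cs , λ R →
            ≡-trans (cong (λ v → det k (v ∷ map row R)) eq)
                (≡-trans (linear-dot cs (map row B) (map row R)) (dot-map _ row cs B))
        }
        where
        open AlternatingForm {D = det k} (det-linear k) (det-alternating k) (det-antisymmetric k)

-- Choice of the sizes and the final count of points.

module Contradiction {p h q k : ℕ} (p-prime : Prime p) (q≡pʰ : q ≡ p ℕ.^ h) (p*p≤q : p ℕ.* p ℕ.≤ q)
         (𝔽 : FiniteField q) (𝔸 : ArcForm 𝔽 k (2 ℕ.+ q)) where

  open Weights 𝔽 𝔸 using (I; points; length-points)
  open InclusionSystem 𝔽 {I} using (flatten)
  open Elimination 𝔽 𝔸 using (absurdity)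
  open Characteristic 𝔽 using (j·1≢0)

  splitAt : ∀ m (L : List I) {n} → length L ≡ m ℕ.+ n → ∃₂ λ A B → L ≡ A ++ B × length A ≡ m × length B ≡ n
  splitAt zero L len = [] , L , refl , refl , len
  splitAt (suc m) (x ∷ L) len with A , B , refl , lenA , lenB ← splitAt m L (ℕₚ.suc-injective len) =
    x ∷ A , B , refl , cong suc lenA , lenB

  pairing : ∀ n (L : List I) → length L ≡ n ℕ.+ n → ∃[ P ] flatten P ≡ L × length P ≡ n
  pairing zero [] _ = [] , refl , refl
  pairing (suc n) (x ∷ []) len = contradiction (≡-trans (ℕₚ.suc-injective len) (ℕₚ.+-suc n n)) λ ()
  pairing (suc n) (x ∷ y ∷ L) len
    with P , refl , refl ← pairing n L (ℕₚ.suc-injective (≡-trans (ℕₚ.suc-injective len) (ℕₚ.+-suc n n))) =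
    (x , y) ∷ P , refl , refl

  n≤n*n : ∀ n → n ℕ.≤ n ℕ.* n
  n≤n*n zero = ℕ.z≤n
  n≤n*n (suc n) = ℕₚ.m≤m*n (suc n) (suc n)

  -- The pairs take 2n points, `V` takes n + e + 1, `H` takes e and `W` takes 2n: in all 5n + 2e + 1
  -- of the q + 2 available. That `q` is not prime enters here, through p² ≤ q.
  enoughPoints : ∀ n e → 2 ℕ.+ (n ℕ.+ e) ℕ.≤ p → 5 ℕ.* n ℕ.+ 2 ℕ.* e ℕ.≤ q
  enoughPoints n e le = begin
    5 ℕ.* n ℕ.+ 2 ℕ.* e
      ≡⟨ arith n e ⟩
    n ℕ.+ (4 ℕ.* n ℕ.+ 2 ℕ.* e)
      ≤⟨ ℕₚ.+-monoˡ-≤ _ (n≤n*n n) ⟩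
    n ℕ.* n ℕ.+ (4 ℕ.* n ℕ.+ 2 ℕ.* e)
      ≤⟨ ℕₚ.m≤m+n _ (e ℕ.* e ℕ.+ 4 ℕ.+ 2 ℕ.* (n ℕ.* e) ℕ.+ 2 ℕ.* e) ⟩
    n ℕ.* n ℕ.+ (4 ℕ.* n ℕ.+ 2 ℕ.* e) ℕ.+ (e ℕ.* e ℕ.+ 4 ℕ.+ 2 ℕ.* (n ℕ.* e) ℕ.+ 2 ℕ.* e)
      ≡⟨ arith′ n e ⟩
    (2 ℕ.+ (n ℕ.+ e)) ℕ.* (2 ℕ.+ (n ℕ.+ e))
      ≤⟨ ℕₚ.*-mono-≤ le le ⟩
    p ℕ.* p
      ≤⟨ p*p≤q ⟩
    q ∎
    where
    open ℕₚ.≤-Reasoning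
    arith : ∀ n e → 5 ℕ.* n ℕ.+ 2 ℕ.* e ≡ n ℕ.+ (4 ℕ.* n ℕ.+ 2 ℕ.* e)
    arith = solve-∀
    arith′ : ∀ n e → n ℕ.* n ℕ.+ (4 ℕ.* n ℕ.+ 2 ℕ.* e) ℕ.+ (e ℕ.* e ℕ.+ 4 ℕ.+ 2 ℕ.* (n ℕ.* e) ℕ.+ 2 ℕ.* e)
                     ≡ (2 ℕ.+ (n ℕ.+ e)) ℕ.* (2 ℕ.+ (n ℕ.+ e))
    arith′ = solve-∀

  length-pieces : ∀ n e r → 2 ℕ.+ (5 ℕ.* n ℕ.+ 2 ℕ.* e ℕ.+ r)
      ≡ n ℕ.+ n ℕ.+ (suc (n ℕ.+ e) ℕ.+ (e ℕ.+ ((n ℕ.+ n) ℕ.+ suc r)))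
  length-pieces = solve-∀

  -- Here r = n + e + 1. Of the r - 1 members of `G` outside `V` and the pairs, n are varied as `Z`
  -- and the remaining e are the padding `H`.
  impossible : ∀ n e → 2 ℕ.+ (n ℕ.+ e) ℕ.≤ p → n ℕ.+ (2 ℕ.+ (n ℕ.+ e)) ≡ k → ⊥
  impossible n e le k-eq
    with A , L₁ , eq₁ , lenA , len₁ ← splitAt (n ℕ.+ n) points
      (≡-trans length-points (≡-trans (cong (2 ℕ.+_) (sym (ℕₚ.m+[n∸m]≡n (enoughPoints n e le))))
          (length-pieces n e (q ℕ.∸ (5 ℕ.* n ℕ.+ 2 ℕ.* e)))))
    with V , L₂ , refl , lenV , len₂ ← splitAt (suc (n ℕ.+ e)) L₁ len₁
    with H , L₃ , refl , lenH , len₃ ← splitAt e L₂ len₂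
    with W , R , refl , lenW , _ ← splitAt (n ℕ.+ n) L₃ len₃
    with P , refl , lenP ← pairing n A lenA =
    absurdity P V W H u
      (≡-trans lenW (cong (λ m → m ℕ.+ m) (sym lenP)))
      (≡-trans (cong suc (cong₂ ℕ._+_ lenH lenP)) (≡-trans (cong suc (ℕₚ.+-comm e n)) (sym lenV)))
      (≡-trans (cong₂ (λ a b → suc (a ℕ.+ b)) lenP lenV) (≡-trans (sym (ℕₚ.+-suc n _)) k-eq))
      (λ 0<j j≤V → j·1≢0 {h = h} p-prime q≡pʰ 0<j (ℕₚ.≤-<-trans (ℕₚ.≤-trans j≤V (ℕₚ.≤-reflexive lenV)) le))
      bound
    where
    u : Distinct (flatten P ++ V ++ H ++ W)
    u = unique-++ˡ (flatten P ++ V ++ H ++ W)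
        (subst Distinct (≡-trans eq₁ (sym (≡-trans (++-assoc (flatten P) _ R)
      (cong (flatten P ++_) (≡-trans (++-assoc V _ R) (cong (V ++_) (++-assoc H W R))))))) (allFin⁺ _))
    bound : k ℕ.+ k ℕ.≤ 4 ℕ.+ q
    bound = begin
      k ℕ.+ k                                       ≡⟨ cong (λ m → m ℕ.+ m) (sym k-eq) ⟩
      n ℕ.+ (2 ℕ.+ (n ℕ.+ e)) ℕ.+ (n ℕ.+ (2 ℕ.+ (n ℕ.+ e)))  ≤⟨ ℕₚ.m≤m+n _ n ⟩
      n ℕ.+ (2 ℕ.+ (n ℕ.+ e)) ℕ.+ (n ℕ.+ (2 ℕ.+ (n ℕ.+ e))) ℕ.+ n  ≡⟨ arith′ n e ⟩
      4 ℕ.+ (5 ℕ.* n ℕ.+ 2 ℕ.* e)                   ≤⟨ ℕₚ.+-monoʳ-≤ 4 (enoughPoints n e le) ⟩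
      4 ℕ.+ q                                       ∎
      where
      open ℕₚ.≤-Reasoning
      arith′ : ∀ n e → n ℕ.+ (2 ℕ.+ (n ℕ.+ e)) ℕ.+ (n ℕ.+ (2 ℕ.+ (n ℕ.+ e))) ℕ.+ n ≡ 4 ℕ.+ (5 ℕ.* n ℕ.+ 2 ℕ.* e)
      arith′ = solve-∀

  contradiction-2≤k : 2 ℕ.≤ k → k ℕ.≤ 2 ℕ.* p ℕ.∸ 2 → ⊥
  contradiction-2≤k 2≤k k≤2p-2 with ℕₚ.≤-total k p
  -- No pairs are needed: r = k - 1 is already below p.
  ... | inj₁ k≤p = impossible 0 (k ℕ.∸ 2) (ℕₚ.≤-trans (ℕₚ.≤-reflexive (ℕₚ.m+[n∸m]≡n 2≤k)) k≤p)
      (ℕₚ.m+[n∸m]≡n 2≤k)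
  ... | inj₂ p≤k = impossible n e (ℕₚ.≤-reflexive n+e) (≡-trans (cong (n ℕ.+_) n+e) (ℕₚ.m∸n+n≡m p≤k))
    where
    -- Now r = p - 1, the largest size allowed, so p - 2 vectors are to be divided between `Z` and
    -- `H`. The hypothesis k ≤ 2p - 2 says n ≤ p - 2, and with p ≤ k it makes these truncated
    -- subtractions exact.
    n e : ℕ
    n = k ℕ.∸ p
    e = 2 ℕ.* p ℕ.∸ 2 ℕ.∸ k
    2≤2p : 2 ℕ.≤ 2 ℕ.* p
    2≤2p = ℕₚ.≤-trans 2≤k (ℕₚ.≤-trans k≤2p-2 (ℕₚ.m∸n≤m (2 ℕ.* p) 2))
    n+e : 2 ℕ.+ (n ℕ.+ e) ≡ p
    n+e = ℕₚ.+-cancelˡ-≡ p _ _ (begin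
      p ℕ.+ (2 ℕ.+ (n ℕ.+ e))    ≡⟨ arith p n e ⟩
      2 ℕ.+ ((n ℕ.+ p) ℕ.+ e)    ≡⟨ cong (λ m → 2 ℕ.+ (m ℕ.+ e)) (ℕₚ.m∸n+n≡m p≤k) ⟩
      2 ℕ.+ (k ℕ.+ e)            ≡⟨ cong (2 ℕ.+_) (ℕₚ.m+[n∸m]≡n k≤2p-2) ⟩
      2 ℕ.+ (2 ℕ.* p ℕ.∸ 2)      ≡⟨ ℕₚ.m+[n∸m]≡n 2≤2p ⟩
      2 ℕ.* p                    ≡⟨ cong (p ℕ.+_) (ℕₚ.+-identityʳ p) ⟩
      p ℕ.+ p                    ∎)
      where
      open ≡-Reasoning
      arith : ∀ p n e → p ℕ.+ (2 ℕ.+ (n ℕ.+ e)) ≡ 2 ℕ.+ ((n ℕ.+ p) ℕ.+ e)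
      arith = solve-∀

primePower-square : ∀ {p h q} → Prime p → q ≡ p ℕ.^ h → ¬ Prime q → q ≢ 1 → p ℕ.* p ℕ.≤ q
primePower-square {h = zero} _ q≡1 _ q≢1 = contradiction q≡1 q≢1
primePower-square {p} {suc zero} p-prime q≡p ¬prime _ =
    contradiction (subst Prime (sym (≡-trans q≡p (ℕₚ.*-identityʳ p))) p-prime) ¬prime
primePower-square {p} {suc (suc h)} p-prime refl _ _ =
    ℕₚ.*-monoʳ-≤ p (ℕₚ.m≤m*n p (p ℕ.^ h)
    {{ℕₚ.m^n≢0 p h {{ℕ.nonTrivial⇒nonZero p {{prime⇒nonTrivial p-prime}}}}}})

open import Data.Nat using (_+_; _*_; _∸_; _^_; _≤_; NonZero)

theorem5p2 : ∀ {c ℓ₁ ℓ₂} (p h q k : ℕ) → Prime p → q ≡ p ^ h → ¬ Prime q → NonZero k →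
    (F : HeytingField c ℓ₁ ℓ₂) → HasCardinality (HeytingField.setoid F) q →
    let open VectorSpace F in
    (S : List (Vector (HeytingField.Carrier F) k)) → Unique S →
    EverySubsetOfSizeIsBasis k S →
    k ≤ 2 * p ∸ 2 → length S ≤ q + 1
theorem5p2 p h q k p-prime q≡pʰ ¬prime k≢0 F card S u bases k≤2p-2 = ℕₚ.≮⇒≥ λ q+1<|S| →
  let 2+q≤|S| = subst (_≤ length S) (cong suc (ℕₚ.+-comm q 1)) q+1<|S| in
  case k 2+q≤|S| k≢0 u bases k≤2p-2
  where
  open Transport F card
  open VectorSpace F
  fin1-trivial : ∀ {n} → n ≡ 1 → (x y : Fin n) → x ≡ y
  fin1-trivial refl zero zero = refl
  -- The exponent zero would give q = 1, which is not prime either; it is excluded because zero and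
  -- one differ in a field.
  q≢1 : q ≢ 1
  q≢1 q≡1 = FiniteField.1≢0 finiteField (fin1-trivial q≡1 _ _)
  case : ∀ k {S : List (Vector (HeytingField.Carrier F) k)} → 2 + q ≤ length S → NonZero k → Unique S →
    EverySubsetOfSizeIsBasis k S → k ≤ 2 * p ∸ 2 → ⊥
  -- For k = 1 there is no (k - 2)-set to project from. The vectors are scalars, and q + 2 distinct
  -- ones cannot fit into q elements.
  case (suc zero) 2+q≤|S| _ u bases _
    with i , j , i<j , eq ← pigeonhole (ℕₚ.n≤1+n (suc q)) (λ i → to (vector u bases 2+q≤|S| i zero)) =
    <⇒≢ i<j (vector-injective u bases 2+q≤|S| λ { zero → to-injective eq })
    where
    to-injective : ∀ {x y} → to x ≡ to y → HeytingField._≈_ F x y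
    to-injective {x} {y} eq = HeytingField.trans F (HeytingField.sym F (from-to x))
        (HeytingField.trans F (Inverse.from-cong card eq) (from-to y))
  case (suc (suc k)) 2+q≤|S| _ u bases k≤ =
    Contradiction.contradiction-2≤k {h = h} p-prime q≡pʰ (primePower-square {h = h} p-prime q≡pʰ ¬prime q≢1)
      finiteField (arcForm u bases 2+q≤|S|) (ℕ.s≤s (ℕ.s≤s ℕ.z≤n)) k≤
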